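{- Let $r \geq 2$ and $d \geq 0$ be integers, and set $D = d+1$ and $T = D(r-1)$. Let $a_1, \ldots, a_r$ be indeterminates, and let $\mathsf{V}$ be the generalized Sylvester-Vandermonde matrix, i.e. the $Dr \times Dr$ matrix whose rows are, in order, the coefficient vectors of the polynomials $$(x+a_1)^T, x(x+a_1)^T, \ldots, x^d(x+a_1)^T,\; (x+a_2)^T, \ldots, x^d(x+a_2)^T,\; \ldots,\; (x+a_r)^T, \ldots, x^d(x+a_r)^T$$ in $x$, with coefficients listed in order of increasing powers $x^0, x^1, \ldots, x^{T+d}$. Then, as an identity of polynomials in $a_1, \ldots, a_r$, $$\det(\mathsf{V}) = C \cdot \prod_{1 \leq i < j \leq r} (a_i - a_j)^{D^2}, \qquad \text{where} \qquad C = \frac{\prod_{\ell=0}^{T+d} \binom{T+d}{\ell}}{\prod_{j=0}^{d} \binom{T+d}{j}^{r}} .$$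
   Context: The matrix $\mathsf{V}$ is square because the number of columns is $T + d + 1 = T + D = Dr$. Explicitly, index the rows by pairs $(i,j)$ with $1 \leq i \leq r$, $0 \leq j \leq d$, ordered lexicographically, and the columns by $q = 0, 1, \ldots, T+d$. The entry of $\mathsf{V}$ in row $(i,j)$ and column $q$ is the coefficient of $x^q$ in $x^j (x+a_i)^T$, namely $\binom{T}{T-(q-j)} a_i^{T-(q-j)}$ if $0 \leq q - j \leq T$, and $0$ otherwise. The identity is understood in the polynomial ring $\mathbb{Q}[a_1, \ldots, a_r]$. -}

module Defs where

open import Algebra.Bundles using (CommutativeRing; CommutativeMonoid; Semiring)
import Algebra.Definitions.RawSemiring as RawSemiringDefs
import Algebra.Properties.CommutativeSemigroup as CommutativeSemigroupProperties
import Algebra.Properties.Ring as RingProperties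
open import Data.Bool.Base using (if_then_else_)
open import Data.Fin.Base using (Fin; zero; suc; toℕ; punchIn; quotient; remainder)
open import Data.Fin.Properties using (_<?_)
open import Data.Integer.Base using (+_)
open import Data.List.Base using (List; []; _∷_; map; upTo)
import Data.List.Relation.Unary.All.Properties as All
open import Data.Nat.Base as ℕ using (ℕ; zero; suc; _∸_; _≤_; z≤n; s≤s; NonZero; ≢-nonZero; ≢-nonZero⁻¹)
open import Data.Nat.Combinatorics using (_C_; nCk+nC[k+1]≡[n+1]C[k+1])
open import Data.Nat.ListAction using (product)
open import Data.Nat.ListAction.Properties using (product≢0)
open import Data.Nat.Properties using (m^n≢0; m≤n⇒m≤o+n; m+n≡0⇒m≡0)
open import Data.Product.Base using (_,_)
open import Data.Rational.Base as ℚ using (ℚ)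
open import Data.Rational.Properties using (+-*-commutativeRing)
open import Function.Base using (id)
open import Level using (Level; 0ℓ)
open import Relation.Binary.PropositionalEquality.Core as ≡ using ()
import Relation.Binary.Reasoning.Setoid as SetoidReasoning
open import Relation.Nullary.Decidable.Core using (does)

private
  variable
    c ℓ : Level

module Polynomial (R : CommutativeRing c ℓ) where

  open CommutativeRing R hiding (_-_; zero) renaming (Carrier to A)
  open RingProperties ring using (-0#≈0#)
  open CommutativeSemigroupProperties (CommutativeMonoid.commutativeSemigroup +-commutativeMonoid)
    using (interchange; x∙yz≈y∙xz)
  open SetoidReasoning setoid

  -- Coefficients listed by increasing powers; trailing zeros are allowed,
  -- and the equality _≈ₚ_ ignores them.
  Poly : Set c
  Poly = List A

  coeff : Poly → ℕ → A
  coeff []      _       = 0#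
  coeff (a ∷ _) zero    = a
  coeff (_ ∷ p) (suc n) = coeff p n

  infix 4 _≈ₚ_
  record _≈ₚ_ (p q : Poly) : Set ℓ where
    constructor mk
    field coeff-≈ : ∀ n → coeff p n ≈ coeff q n
  open _≈ₚ_ public

  const : A → Poly
  const a = a ∷ []

  X : Poly
  X = 0# ∷ 1# ∷ []

  infixl 6 _+ₚ_
  infixl 7 _*ₚ_
  infix  8 -ₚ_

  _+ₚ_ : Poly → Poly → Poly
  []      +ₚ q       = q
  (a ∷ p) +ₚ []      = a ∷ p
  (a ∷ p) +ₚ (b ∷ q) = (a + b) ∷ (p +ₚ q)

  -ₚ_ : Poly → Poly
  -ₚ_ = map -_

  _*ₚ_ : Poly → Poly → Poly
  []      *ₚ q = []
  (a ∷ p) *ₚ q = map (a *_) q +ₚ (0# ∷ (p *ₚ q))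

  -- Cauchy product: conv f g n = Σ_{i ≤ n} f i * g (n - i).
  conv : (ℕ → A) → (ℕ → A) → ℕ → A
  conv f g zero    = f 0 * g 0
  conv f g (suc n) = f 0 * g (suc n) + conv (λ i → f (suc i)) g n

  coeff-+ : ∀ p q n → coeff (p +ₚ q) n ≈ coeff p n + coeff q n
  coeff-+ []      q       n       = sym (+-identityˡ _)
  coeff-+ (a ∷ p) []      n       = sym (+-identityʳ _)
  coeff-+ (a ∷ p) (b ∷ q) zero    = refl
  coeff-+ (a ∷ p) (b ∷ q) (suc n) = coeff-+ p q n

  coeff-neg : ∀ p n → coeff (-ₚ p) n ≈ - coeff p n
  coeff-neg []      n       = sym -0#≈0#
  coeff-neg (a ∷ p) zero    = refl
  coeff-neg (a ∷ p) (suc n) = coeff-neg p n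

  coeff-scale : ∀ a p n → coeff (map (a *_) p) n ≈ a * coeff p n
  coeff-scale a []      n       = sym (zeroʳ a)
  coeff-scale a (b ∷ p) zero    = refl
  coeff-scale a (b ∷ p) (suc n) = coeff-scale a p n

  conv-cong : ∀ {f f′ g g′} → (∀ n → f n ≈ f′ n) → (∀ n → g n ≈ g′ n) →
              ∀ n → conv f g n ≈ conv f′ g′ n
  conv-cong f≈ g≈ zero    = *-cong (f≈ 0) (g≈ 0)
  conv-cong f≈ g≈ (suc n) =
    +-cong (*-cong (f≈ 0) (g≈ (suc n))) (conv-cong (λ i → f≈ (suc i)) g≈ n)

  conv-zeroˡ : ∀ g n → conv (λ _ → 0#) g n ≈ 0#
  conv-zeroˡ g zero    = zeroˡ _
  conv-zeroˡ g (suc n) = trans (+-cong (zeroˡ _) (conv-zeroˡ g n)) (+-identityˡ 0#)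

  coeff-* : ∀ p q n → coeff (p *ₚ q) n ≈ conv (coeff p) (coeff q) n
  coeff-* []      q n       = sym (conv-zeroˡ (coeff q) n)
  coeff-* (a ∷ p) q zero    = begin
    coeff (map (a *_) q +ₚ (0# ∷ (p *ₚ q))) 0 ≈⟨ coeff-+ (map (a *_) q) _ 0 ⟩
    coeff (map (a *_) q) 0 + 0#               ≈⟨ +-identityʳ _ ⟩
    coeff (map (a *_) q) 0                    ≈⟨ coeff-scale a q 0 ⟩
    a * coeff q 0                             ∎
  coeff-* (a ∷ p) q (suc n) = begin
    coeff (map (a *_) q +ₚ (0# ∷ (p *ₚ q))) (suc n)  ≈⟨ coeff-+ (map (a *_) q) _ (suc n) ⟩
    coeff (map (a *_) q) (suc n) + coeff (p *ₚ q) n  ≈⟨ +-cong (coeff-scale a q (suc n)) (coeff-* p q n) ⟩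
    a * coeff q (suc n) + conv (coeff p) (coeff q) n ∎

  conv-sucʳ : ∀ f g n → conv f g (suc n) ≈ f (suc n) * g 0 + conv f (λ i → g (suc i)) n
  conv-sucʳ f g zero    = +-comm _ _
  conv-sucʳ f g (suc n) = begin
    f 0 * g (suc (suc n)) + conv (λ i → f (suc i)) g (suc n)
      ≈⟨ +-congˡ (conv-sucʳ (λ i → f (suc i)) g n) ⟩
    f 0 * g (suc (suc n)) + (f (suc (suc n)) * g 0 + conv (λ i → f (suc i)) (λ i → g (suc i)) n)
      ≈⟨ x∙yz≈y∙xz _ _ _ ⟩
    f (suc (suc n)) * g 0 + (f 0 * g (suc (suc n)) + conv (λ i → f (suc i)) (λ i → g (suc i)) n)
      ∎

  conv-comm : ∀ f g n → conv f g n ≈ conv g f n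
  conv-comm f g zero    = *-comm _ _
  conv-comm f g (suc n) = begin
    f 0 * g (suc n) + conv (λ i → f (suc i)) g n ≈⟨ +-cong (*-comm _ _) (conv-comm (λ i → f (suc i)) g n) ⟩
    g (suc n) * f 0 + conv g (λ i → f (suc i)) n ≈⟨ conv-sucʳ g f n ⟨
    conv g f (suc n)                             ∎

  conv-distribʳ : ∀ f g h n → conv (λ i → f i + g i) h n ≈ conv f h n + conv g h n
  conv-distribʳ f g h zero    = distribʳ _ _ _
  conv-distribʳ f g h (suc n) = trans
    (+-cong (distribʳ _ _ _) (conv-distribʳ (λ i → f (suc i)) (λ i → g (suc i)) h n))
    (interchange _ _ _ _)

  conv-scaleˡ : ∀ a f g n → conv (λ i → a * f i) g n ≈ a * conv f g n
  conv-scaleˡ a f g zero    = *-assoc _ _ _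
  conv-scaleˡ a f g (suc n) = trans
    (+-cong (*-assoc _ _ _) (conv-scaleˡ a (λ i → f (suc i)) g n))
    (sym (distribˡ _ _ _))

  conv-assoc : ∀ f g h n → conv (conv f g) h n ≈ conv f (conv g h) n
  conv-assoc f g h zero    = *-assoc _ _ _
  conv-assoc f g h (suc n) = begin
    (f 0 * g 0) * h (suc n) + conv (λ i → f 0 * g (suc i) + conv f′ g i) h n
      ≈⟨ +-cong (*-assoc _ _ _) (conv-distribʳ (λ i → f 0 * g (suc i)) (conv f′ g) h n) ⟩
    f 0 * (g 0 * h (suc n)) + (conv (λ i → f 0 * g (suc i)) h n + conv (conv f′ g) h n)
      ≈⟨ +-congˡ (+-cong (conv-scaleˡ (f 0) (λ i → g (suc i)) h n) (conv-assoc f′ g h n)) ⟩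
    f 0 * (g 0 * h (suc n)) + (f 0 * conv (λ i → g (suc i)) h n + conv f′ (conv g h) n)
      ≈⟨ +-assoc _ _ _ ⟨
    (f 0 * (g 0 * h (suc n)) + f 0 * conv (λ i → g (suc i)) h n) + conv f′ (conv g h) n
      ≈⟨ +-congʳ (distribˡ _ _ _) ⟨
    f 0 * conv g h (suc n) + conv f′ (conv g h) n
      ∎
    where f′ = λ i → f (suc i)

  private
    +ₚ-cong : ∀ {p p′ q q′} → p ≈ₚ p′ → q ≈ₚ q′ → p +ₚ q ≈ₚ p′ +ₚ q′
    +ₚ-cong {p} {p′} {q} {q′} (mk e) (mk e′) = mk λ n →
      trans (coeff-+ p q n) (trans (+-cong (e n) (e′ n)) (sym (coeff-+ p′ q′ n)))

    *ₚ-cong : ∀ {p p′ q q′} → p ≈ₚ p′ → q ≈ₚ q′ → p *ₚ q ≈ₚ p′ *ₚ q′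
    *ₚ-cong {p} {p′} {q} {q′} (mk e) (mk e′) = mk λ n →
      trans (coeff-* p q n) (trans (conv-cong e e′ n) (sym (coeff-* p′ q′ n)))

    -ₚ-cong : ∀ {p p′} → p ≈ₚ p′ → -ₚ p ≈ₚ -ₚ p′
    -ₚ-cong {p} {p′} (mk e) = mk λ n →
      trans (coeff-neg p n) (trans (-‿cong (e n)) (sym (coeff-neg p′ n)))

    +ₚ-assoc : ∀ p q s → (p +ₚ q) +ₚ s ≈ₚ p +ₚ (q +ₚ s)
    +ₚ-assoc p q s = mk λ n → begin
      coeff ((p +ₚ q) +ₚ s) n               ≈⟨ coeff-+ (p +ₚ q) s n ⟩
      coeff (p +ₚ q) n + coeff s n          ≈⟨ +-congʳ (coeff-+ p q n) ⟩
      (coeff p n + coeff q n) + coeff s n   ≈⟨ +-assoc _ _ _ ⟩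
      coeff p n + (coeff q n + coeff s n)   ≈⟨ +-congˡ (coeff-+ q s n) ⟨
      coeff p n + coeff (q +ₚ s) n          ≈⟨ coeff-+ p (q +ₚ s) n ⟨
      coeff (p +ₚ (q +ₚ s)) n               ∎

    +ₚ-comm : ∀ p q → p +ₚ q ≈ₚ q +ₚ p
    +ₚ-comm p q = mk λ n →
      trans (coeff-+ p q n) (trans (+-comm _ _) (sym (coeff-+ q p n)))

    +ₚ-identityˡ : ∀ p → [] +ₚ p ≈ₚ p
    +ₚ-identityˡ p = mk λ _ → refl

    -ₚ-inverseˡ : ∀ p → -ₚ p +ₚ p ≈ₚ []
    -ₚ-inverseˡ p = mk λ n →
      trans (coeff-+ (-ₚ p) p n) (trans (+-congʳ (coeff-neg p n)) (-‿inverseˡ _))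

    *ₚ-assoc : ∀ p q s → (p *ₚ q) *ₚ s ≈ₚ p *ₚ (q *ₚ s)
    *ₚ-assoc p q s = mk λ n → begin
      coeff ((p *ₚ q) *ₚ s) n                        ≈⟨ coeff-* (p *ₚ q) s n ⟩
      conv (coeff (p *ₚ q)) (coeff s) n              ≈⟨ conv-cong (coeff-* p q) (λ _ → refl) n ⟩
      conv (conv (coeff p) (coeff q)) (coeff s) n    ≈⟨ conv-assoc (coeff p) (coeff q) (coeff s) n ⟩
      conv (coeff p) (conv (coeff q) (coeff s)) n    ≈⟨ conv-cong (λ _ → refl) (coeff-* q s) n ⟨
      conv (coeff p) (coeff (q *ₚ s)) n              ≈⟨ coeff-* p (q *ₚ s) n ⟨
      coeff (p *ₚ (q *ₚ s)) n                        ∎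

    *ₚ-comm : ∀ p q → p *ₚ q ≈ₚ q *ₚ p
    *ₚ-comm p q = mk λ n →
      trans (coeff-* p q n) (trans (conv-comm (coeff p) (coeff q) n) (sym (coeff-* q p n)))

    *ₚ-identityˡ : ∀ p → const 1# *ₚ p ≈ₚ p
    *ₚ-identityˡ p = mk λ n → begin
      coeff (map (1# *_) p +ₚ (0# ∷ [])) n       ≈⟨ coeff-+ (map (1# *_) p) _ n ⟩
      coeff (map (1# *_) p) n + coeff (0# ∷ []) n ≈⟨ +-cong (coeff-scale 1# p n) (coeff-0 n) ⟩
      1# * coeff p n + 0#                         ≈⟨ +-identityʳ _ ⟩
      1# * coeff p n                              ≈⟨ *-identityˡ _ ⟩
      coeff p n                                   ∎
      where
      coeff-0 : ∀ n → coeff (0# ∷ []) n ≈ 0#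
      coeff-0 zero    = refl
      coeff-0 (suc _) = refl

    *ₚ-distribʳ : ∀ s p q → (p +ₚ q) *ₚ s ≈ₚ p *ₚ s +ₚ q *ₚ s
    *ₚ-distribʳ s p q = mk λ n → begin
      coeff ((p +ₚ q) *ₚ s) n                                     ≈⟨ coeff-* (p +ₚ q) s n ⟩
      conv (coeff (p +ₚ q)) (coeff s) n                           ≈⟨ conv-cong (coeff-+ p q) (λ _ → refl) n ⟩
      conv (λ i → coeff p i + coeff q i) (coeff s) n              ≈⟨ conv-distribʳ (coeff p) (coeff q) (coeff s) n ⟩
      conv (coeff p) (coeff s) n + conv (coeff q) (coeff s) n     ≈⟨ +-cong (coeff-* p s n) (coeff-* q s n) ⟨
      coeff (p *ₚ s) n + coeff (q *ₚ s) n                         ≈⟨ coeff-+ (p *ₚ s) (q *ₚ s) n ⟨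
      coeff (p *ₚ s +ₚ q *ₚ s) n                                  ∎

    ≈ₚ-trans : ∀ {p q s} → p ≈ₚ q → q ≈ₚ s → p ≈ₚ s
    ≈ₚ-trans (mk e) (mk e′) = mk λ n → trans (e n) (e′ n)

  commutativeRing : CommutativeRing c ℓ
  commutativeRing = record
    { Carrier = Poly
    ; _≈_ = _≈ₚ_
    ; _+_ = _+ₚ_
    ; _*_ = _*ₚ_
    ; -_  = -ₚ_
    ; 0#  = []
    ; 1#  = const 1#
    ; isCommutativeRing = record
      { isRing = record
        { +-isAbelianGroup = record
          { isGroup = record
            { isMonoid = record
              { isSemigroup = record
                { isMagma = record
                  { isEquivalence = record
                    { refl  = mk λ _ → refl
                    ; sym   = λ (mk e) → mk λ n → sym (e n)
                    ; trans = ≈ₚ-trans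
                    }
                  ; ∙-cong = +ₚ-cong
                  }
                ; assoc = +ₚ-assoc
                }
              ; identity = +ₚ-identityˡ , λ p → ≈ₚ-trans (+ₚ-comm p []) (+ₚ-identityˡ p)
              }
            ; inverse = -ₚ-inverseˡ , λ p → ≈ₚ-trans (+ₚ-comm p (-ₚ p)) (-ₚ-inverseˡ p)
            ; ⁻¹-cong = -ₚ-cong
            }
          ; comm = +ₚ-comm
          }
        ; *-cong = *ₚ-cong
        ; *-assoc = *ₚ-assoc
        ; *-identity = *ₚ-identityˡ , λ p → ≈ₚ-trans (*ₚ-comm p (const 1#)) (*ₚ-identityˡ p)
        ; distrib =
            (λ s p q → ≈ₚ-trans (*ₚ-comm s (p +ₚ q))
                         (≈ₚ-trans (*ₚ-distribʳ s p q) (+ₚ-cong (*ₚ-comm p s) (*ₚ-comm q s))))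
          , *ₚ-distribʳ
        }
      ; *-comm = *ₚ-comm
      }
    }

-- The polynomial ring ℚ[a₁,…,aᵣ], built by adjoining one indeterminate at a
-- time; the outermost indeterminate is a₁ = var zero.
ℚ[a] : ℕ → CommutativeRing 0ℓ 0ℓ
ℚ[a] zero    = +-*-commutativeRing
ℚ[a] (suc r) = Polynomial.commutativeRing (ℚ[a] r)

ℚ[a]-Carrier : ℕ → Set
ℚ[a]-Carrier r = CommutativeRing.Carrier (ℚ[a] r)

var : ∀ {r} → Fin r → ℚ[a]-Carrier r
var {suc r} zero    = Polynomial.X (ℚ[a] r)
var {suc r} (suc i) = Polynomial.const (ℚ[a] r) (var i)

fromℚ : ∀ r → ℚ → ℚ[a]-Carrier r
fromℚ zero    c = c
fromℚ (suc r) c = Polynomial.const (ℚ[a] r) (fromℚ r c)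

module Determinant (R : CommutativeRing c ℓ) where

  open CommutativeRing R hiding (zero) renaming (Carrier to A)
  open RawSemiringDefs (Semiring.rawSemiring semiring) using (_^_; sum)

  Matrix : ℕ → Set c
  Matrix n = Fin n → Fin n → A

  -- Laplace expansion along the first row.
  det : ∀ {n} → Matrix n → A
  det {zero}  M = 1#
  det {suc n} M =
    sum λ j → (- 1#) ^ toℕ j * (M zero j * det λ i k → M (suc i) (punchIn j k))

module Products (R : CommutativeRing c ℓ) where

  open CommutativeRing R hiding (zero) renaming (Carrier to A)
  open RawSemiringDefs (Semiring.rawSemiring semiring) using (_^_) renaming (product to ∏) public

  ∏[i<j] : ∀ {n} → (Fin n → Fin n → A) → A
  ∏[i<j] f = ∏ λ i → ∏ λ j → if does (i <? j) then f i j else 1#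

D : ℕ → ℕ
D d = suc d

T : ℕ → ℕ → ℕ
T r d = D d ℕ.* (r ∸ 1)

module _ (r d : ℕ) where

  -- Row i * D + j, with 0 ≤ i < r and 0 ≤ j ≤ d, is the coefficient vector of
  -- x^j (x + aᵢ₊₁)^T; the r * D columns are the powers x^0, …, x^(T + d).
  module _ (R : CommutativeRing c ℓ) where
    open CommutativeRing R using (Carrier)
    open Polynomial R using (Poly; X; const; coeff; commutativeRing)
    open CommutativeRing commutativeRing using (_+_; _*_; semiring)
    open RawSemiringDefs (Semiring.rawSemiring semiring) using (_^_)

    rowPoly : (Fin r → Carrier) → Fin r → Fin (D d) → Poly
    rowPoly a i j = X ^ toℕ j * (X + const (a i)) ^ T r d

    sylvesterVandermonde : (Fin r → Carrier) → Determinant.Matrix R (r ℕ.* D d)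
    sylvesterVandermonde a row q =
      coeff (rowPoly a (quotient (D d) row) (remainder {r} (D d) row)) (toℕ q)

  numerator denominator : ℕ
  numerator   = product (map (λ l → (T r d ℕ.+ d) C l) (upTo (suc (T r d ℕ.+ d))))
  denominator = product (map (λ j → ((T r d ℕ.+ d) C j) ℕ.^ r) (upTo (suc d)))

  private
    C-nonZero : ∀ {n k} → k ≤ n → NonZero (n C k)
    C-nonZero z≤n = _
    C-nonZero (s≤s {k} {n} k≤n) = ≢-nonZero λ eq →
      ≢-nonZero⁻¹ (n C k) {{C-nonZero k≤n}}
        (m+n≡0⇒m≡0 (n C k) (≡.trans (nCk+nC[k+1]≡[n+1]C[k+1] n k) eq))

  denominator-nonZero : NonZero denominator
  denominator-nonZero = product≢0 (All.map⁺ {f = λ j → ((T r d ℕ.+ d) C j) ℕ.^ r}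
    (All.applyUpTo⁺₁ id (suc d)
      λ { {j} (s≤s j≤d) → m^n≢0 ((T r d ℕ.+ d) C j) r {{C-nonZero (m≤n⇒m≤o+n (T r d) j≤d)}} }))

  constantC : ℚ
  constantC = (+ numerator ℚ./ denominator) {{denominator-nonZero}}

{-# OPTIONS --safe #-}
-- Write N = T + d, so that V has N + 1 columns.  Expanding (x + aᵢ)^j binomially turns
-- the rows x^j (x + aᵢ)^T, by a unitriangular row operation, into (x + aᵢ)^(T + j).  With
-- k = d - j, the coefficient of x^q in (x + aᵢ)^(N - k) is C(N,q) / C(N,k) times the k-th
-- Hasse derivative of x^(N - q) at aᵢ; the scalings give the constant C and leave a
-- confluent Vandermonde matrix.  Replacing the monomials by the Newton basis with each aₛ
-- as a root of multiplicity D is a unitriangular column operation that makes this matrix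
-- triangular, and block i has D diagonal entries, each equal to ∏_{s > i} (aᵢ - aₛ)^D.
module Submission where

open import Defs
open import Algebra.Bundles using (CommutativeMonoid; CommutativeRing)
import Algebra.Properties.CommutativeMonoid.Sum as MonoidSum
import Algebra.Properties.CommutativeSemigroup as CommutativeSemigroupProperties
import Algebra.Properties.CommutativeSemiring.Exp as Exp
import Algebra.Properties.Ring as RingProperties
import Algebra.Properties.Semiring.Mult as Mult
import Algebra.Properties.Semiring.Sum as SemiringSum
open import Data.Bool.Base using (true; false; if_then_else_)
open import Data.Fin.Base using (Fin; zero; suc; toℕ; punchIn; punchOut; combine; quotient; remainder; remQuot; opposite; _↑ˡ_; _↑ʳ_; _<_)
open import Data.Fin.Permutation using (reverse)
open import Data.Fin.Properties using (_≟_; _<?_; <-cmp; toℕ<n; toℕ-↑ˡ; toℕ-↑ʳ; suc-injective; punchIn-injective; punchIn-punchOut; punchInᵢ≢i; toℕ-combine; combine-monoˡ-<; combine-remQuot; remQuot-combine; opposite-prop)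
open import Data.Integer.Base as ℤ using () renaming (+_ to pos)
import Data.Integer.Properties as ℤ
open import Data.List.Base using (List; []; _∷_; _++_; map; replicate; length; applyUpTo; upTo)
open import Data.List.Properties using (map-++; map-replicate; length-++; length-replicate; ++-identityʳ)
open import Data.List.Relation.Binary.Pointwise as Pointwise using (Pointwise; []; _∷_)
open import Data.Nat.Base as ℕ using (ℕ; zero; suc; _∸_; _≤_; z≤n; s≤s; _!; NonZero)
open import Data.Nat.Combinatorics using (_C_; nCk≡n!/k![n-k]!; k>n⇒nCk≡0; nCk+nC[k+1]≡[n+1]C[k+1]; k![n∸k]!∣n!)
open import Data.Nat.DivMod using (m/n*n≡m)
open import Data.Nat.ListAction using (product)
import Data.Nat.Properties as ℕ
open import Data.Product.Base using (_×_; _,_; proj₁; proj₂)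
open import Data.Rational.Base as ℚ using (ℚ; 1ℚ; toℚᵘ)
open import Data.Rational.Properties using (toℚᵘ-injective; toℚᵘ-homo-+; toℚᵘ-homo-*; toℚᵘ-fromℚᵘ)
open import Data.Rational.Unnormalised.Base as ℚᵘ using (mkℚᵘ; *≡*)
import Data.Rational.Unnormalised.Properties as ℚᵘ
open import Data.Sum.Base using (_⊎_; inj₁; inj₂)
open import Data.Vec.Functional using () renaming (_∷_ to _∷ᵥ_)
open import Function.Base using (_∘_; id)
open import Level using (_⊔_)
open import Relation.Binary.Definitions using (tri<; tri≈; tri>)
open import Relation.Binary.PropositionalEquality as ≡ using (_≡_; _≢_)
import Relation.Binary.Reasoning.Setoid as SetoidReasoning
open import Relation.Nullary.Decidable.Core using (does; yes; no)
open import Relation.Nullary.Negation.Core using (contradiction)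

-- `det` is given only by expansion along the first row, so its behaviour under row operations and
-- products has to be earned. That expansion shows alternation in the columns by direct induction.
-- Conversely, any form alternating in the rows is `det` times its value at the identity. Applied to
-- `det` of the transpose, this gives transposition invariance, then row alternation, then
-- multiplicativity.
--
-- Nothing is divided before the end: the scalings by C(N,k) and C(N,q) stay on opposite sides,
-- which gives an identity over every commutative ring and for arbitrary values aᵢ, coinciding ones
-- included. Only in ℚ[a] is the denominator inverted.
--
-- Polynomials are handled as products of factors x + c, recorded by the list of the c. Translation
-- by aᵢ adds aᵢ to each entry, and the k-th Hasse derivative at aᵢ is coefficient k after
-- translation, so the vanishing that is needed is read off from the zero entries. The order d - j
-- and the exponent N - q both run backwards, so the Newton matrix and the product are triangular as
-- they stand and no permutation sign appears.

data Adjacent : ∀ {n} → Fin n → Fin n → Set where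
  here  : ∀ {n} → Adjacent {suc (suc n)} zero (suc zero)
  there : ∀ {n} {p q : Fin n} → Adjacent p q → Adjacent (suc p) (suc q)

-- In a Laplace term column j is deleted. Either it belongs to the adjacent pair, or the pair
-- survives and is still adjacent in the minor, so that an induction can go on.
data Avoidance {n} (j p q : Fin (suc n)) : Set where
  left   : j ≡ p → Avoidance j p q
  right  : j ≡ q → Avoidance j p q
  avoids : ∀ p′ q′ → Adjacent p′ q′ → punchIn j p′ ≡ p → punchIn j q′ ≡ q → Avoidance j p q

avoidance : ∀ {n} {p q : Fin (suc n)} → Adjacent p q → ∀ j → Avoidance j p q
avoidance here zero = left ≡.refl
avoidance here (suc zero) = right ≡.refl
avoidance {suc (suc n)} here (suc (suc j)) = avoids zero (suc zero) here ≡.refl ≡.refl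
avoidance (there adj) zero = avoids _ _ adj ≡.refl ≡.refl
avoidance {suc n} (there adj) (suc j) with avoidance adj j
... | left eq  = left (≡.cong suc eq)
... | right eq = right (≡.cong suc eq)
... | avoids p′ q′ adj′ eqp eqq =
  avoids (suc p′) (suc q′) (there adj′) (≡.cong suc eqp) (≡.cong suc eqq)

-- The minors obtained by deleting p or q differ at one position only, where one keeps q and the
-- other p. They agree when columns p and q are equal.
punchIn-adjacent : ∀ {n} {p q : Fin (suc n)} → Adjacent p q → ∀ k →
  punchIn p k ≡ punchIn q k ⊎ (punchIn p k ≡ q × punchIn q k ≡ p)
punchIn-adjacent here zero    = inj₂ (≡.refl , ≡.refl)
punchIn-adjacent here (suc k) = inj₁ ≡.refl
punchIn-adjacent (there adj) zero = inj₁ ≡.refl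
punchIn-adjacent (there adj) (suc k) with punchIn-adjacent adj k
... | inj₁ eq          = inj₁ (≡.cong suc eq)
... | inj₂ (eqp , eqq) = inj₂ (≡.cong suc eqp , ≡.cong suc eqq)

-- Determinants as alternating multilinear forms.

module DeterminantProperties {c ℓ} (R : CommutativeRing c ℓ) where

  open CommutativeRing R hiding (zero) renaming (Carrier to A)
  open Determinant R
  open Products R using (∏)
  open Exp commutativeSemiring using (_^_)
  open RingProperties ring using (-1*x≈-x; -‿involutive; -‿distribˡ-*; -‿distribʳ-*; x+x≈x⇒x≈0)
  open SemiringSum semiring
    using (sum; sum-cong-≋; sum-remove; ∑-distrib-+; *-distribˡ-sum; *-distribʳ-sum; sum-replicate-zero)
  open CommutativeSemigroupProperties *-commutativeSemigroup using (x∙yz≈y∙xz)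
  open SetoidReasoning setoid

  -- Rectangular, because the uniqueness proof fixes a first row and studies forms in n rows of
  -- length n + 1.
  Rows : ℕ → ℕ → Set c
  Rows n m = Fin n → Fin m → A

  infix 4 _≈ᵥ_ _≈ᵣ_
  _≈ᵥ_ : ∀ {m} → (v w : Fin m → A) → Set ℓ
  v ≈ᵥ w = ∀ k → v k ≈ w k

  _≈ᵣ_ : ∀ {n m} → (M N : Rows n m) → Set ℓ
  M ≈ᵣ N = ∀ i → M i ≈ᵥ N i

  sum≈0 : ∀ {n} (f : Fin n → A) → (∀ i → f i ≈ 0#) → sum f ≈ 0#
  sum≈0 {n} f f≈0 = trans (sum-cong-≋ f≈0) (sum-replicate-zero n)

  δ : ∀ {n} → Rows n n
  δ zero    zero    = 1#
  δ zero    (suc _) = 0#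
  δ (suc _) zero    = 0#
  δ (suc i) (suc k) = δ i k

  δ-sym : ∀ {n} (i k : Fin n) → δ i k ≈ δ k i
  δ-sym zero    zero    = refl
  δ-sym zero    (suc _) = refl
  δ-sym (suc _) zero    = refl
  δ-sym (suc i) (suc k) = δ-sym i k

  δ-diag : ∀ {n} (i : Fin n) → δ i i ≈ 1#
  δ-diag zero    = refl
  δ-diag (suc i) = δ-diag i

  sum-δ : ∀ {n} (x : Fin n → A) k → sum (λ j → x j * δ j k) ≈ x k
  sum-δ x zero = begin
    x zero * 1# + sum (λ j → x (suc j) * 0#) ≈⟨ +-cong (*-identityʳ _) (sum≈0 _ λ j → zeroʳ (x (suc j))) ⟩
    x zero + 0#                              ≈⟨ +-identityʳ _ ⟩
    x zero                                   ∎
  sum-δ x (suc k) = begin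
    x zero * 0# + sum (λ j → x (suc j) * δ j k) ≈⟨ +-cong (zeroʳ _) (sum-δ (x ∘ suc) k) ⟩
    0# + x (suc k)                              ≈⟨ +-identityˡ _ ⟩
    x (suc k)                                   ∎

  sum-linear : ∀ {n} x (f g : Fin n → A) → sum (λ j → f j + x * g j) ≈ sum f + x * sum g
  sum-linear x f g = trans (∑-distrib-+ f _) (+-congˡ (sym (*-distribˡ-sum x g)))

  infixl 7 _·_
  _·_ : ∀ {n m l} → Rows n m → Rows m l → Rows n l
  (M · B) i k = sum λ j → M i j * B j k

  -- One field covers additivity and homogeneity. The three matrices are related pointwise instead
  -- of being built by updating a row, so any matrices of the right shape up to `≈` can be supplied.
  record Multilinear {n m} (F : Rows n m → A) : Set (c ⊔ ℓ) where
    field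
      respects : ∀ {M N} → M ≈ᵣ N → F M ≈ F N
      linear   : ∀ i x {L M N} → (∀ k → L i k ≈ M i k + x * N i k) →
                 (∀ {j} → j ≢ i → L j ≈ᵥ M j) → (∀ {j} → j ≢ i → L j ≈ᵥ N j) →
                 F L ≈ F M + x * F N

  -- Equality is tested on adjacent rows only, the case that the induction on the expansion
  -- delivers; `repeated-head` recovers a later row equal to the first.
  record Alternating {n m} (F : Rows n m → A) : Set (c ⊔ ℓ) where
    field
      multilinear : Multilinear F
      adjacent    : ∀ {p q} → Adjacent p q → ∀ {M} → M p ≈ᵥ M q → F M ≈ 0#
    open Multilinear multilinear public

  open Multilinear
  open Alternating using (multilinear; adjacent)

  ∷-cong : ∀ {n m} {v w : Fin m → A} {M N : Rows n m} → v ≈ᵥ w → M ≈ᵣ N → (v ∷ᵥ M) ≈ᵣ (w ∷ᵥ N)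
  ∷-cong v≈w M≈N zero    = v≈w
  ∷-cong v≈w M≈N (suc i) = M≈N i

  uncons : ∀ {n m} (M : Rows (suc n) m) → M ≈ᵣ (M zero ∷ᵥ M ∘ suc)
  uncons M zero    k = refl
  uncons M (suc i) k = refl

  multilinear-∷ : ∀ {n m} {F : Rows (suc n) m → A} → Multilinear F → ∀ v → Multilinear (λ M → F (v ∷ᵥ M))
  multilinear-∷ mF v .respects M≈N = mF .respects (∷-cong (λ _ → refl) M≈N)
  multilinear-∷ mF v .linear i x {L} {M} {N} eq L≈M L≈N =
    mF .linear (suc i) x eq
      (λ { {zero} _ k → refl ; {suc j} j≢i → L≈M (j≢i ∘ ≡.cong suc) })
      (λ { {zero} _ k → refl ; {suc j} j≢i → L≈N (j≢i ∘ ≡.cong suc) })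

  alternating-∷ : ∀ {n m} {F : Rows (suc n) m → A} → Alternating F → ∀ v → Alternating (λ M → F (v ∷ᵥ M))
  alternating-∷ aF v .multilinear      = multilinear-∷ (aF .multilinear) v
  alternating-∷ aF v .adjacent adj eq = aF .adjacent (there adj) eq

  multilinear-· : ∀ {n m l} {F : Rows n l → A} → Multilinear F → (B : Rows m l) → Multilinear (λ M → F (M · B))
  multilinear-· mF B .respects M≈N = mF .respects λ i k → sum-cong-≋ λ j → *-congʳ (M≈N i j)
  multilinear-· mF B .linear i x {L} {M} {N} eq L≈M L≈N =
    mF .linear i x
      (λ k → begin
        sum (λ j → L i j * B j k)                             ≈⟨ sum-cong-≋ (λ j → *-congʳ (eq j)) ⟩
        sum (λ j → (M i j + x * N i j) * B j k)               ≈⟨ sum-cong-≋ (λ j → distribʳ (B j k) (M i j) _) ⟩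
        sum (λ j → M i j * B j k + (x * N i j) * B j k)       ≈⟨ sum-cong-≋ (λ j → +-congˡ {M i j * B j k} (*-assoc x (N i j) _)) ⟩
        sum (λ j → M i j * B j k + x * (N i j * B j k))       ≈⟨ sum-linear x (λ j → M i j * B j k) _ ⟩
        sum (λ j → M i j * B j k) + x * sum (λ j → N i j * B j k) ∎)
      (λ j≢i k → sum-cong-≋ λ l → *-congʳ (L≈M j≢i l))
      (λ j≢i k → sum-cong-≋ λ l → *-congʳ (L≈N j≢i l))

  alternating-· : ∀ {n m l} {F : Rows n l → A} → Alternating F → (B : Rows m l) → Alternating (λ M → F (M · B))
  alternating-· aF B .multilinear     = multilinear-· (aF .multilinear) B
  alternating-· aF B .adjacent adj eq = aF .adjacent adj λ k → sum-cong-≋ λ j → *-congʳ (eq j)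

  alternating-resp : ∀ {n m} {F G : Rows n m → A} → (∀ M → F M ≈ G M) → Alternating F → Alternating G
  alternating-resp F≈G aF .multilinear .respects M≈N =
    trans (sym (F≈G _)) (trans (aF .multilinear .respects M≈N) (F≈G _))
  alternating-resp F≈G aF .multilinear .linear i x eq L≈M L≈N =
    trans (sym (F≈G _)) (trans (aF .multilinear .linear i x eq L≈M L≈N) (+-cong (F≈G _) (*-congˡ (F≈G _))))
  alternating-resp F≈G aF .adjacent adj eq = trans (sym (F≈G _)) (aF .adjacent adj eq)

  module _ {n m} {F : Rows (suc n) m → A} (mF : Multilinear F) where

    linear-head : ∀ x {u v w} (M : Rows n m) → (∀ k → u k ≈ v k + x * w k) →
                  F (u ∷ᵥ M) ≈ F (v ∷ᵥ M) + x * F (w ∷ᵥ M)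
    linear-head x M eq = mF .linear zero x eq
      (λ { {zero} j≢i → contradiction ≡.refl j≢i ; {suc j} _ k → refl })
      (λ { {zero} j≢i → contradiction ≡.refl j≢i ; {suc j} _ k → refl })

    -- A zero vector satisfies v = v + 1 v, so linearity gives F = F + F.
    zero-head : ∀ {v} (M : Rows n m) → (∀ k → v k ≈ 0#) → F (v ∷ᵥ M) ≈ 0#
    zero-head {v} M v≈0 = x+x≈x⇒x≈0 _ (sym (begin
      F (v ∷ᵥ M)                  ≈⟨ linear-head 1# M (λ k → trans (sym (+-identityʳ _)) (+-congˡ (sym (trans (*-identityˡ _) (v≈0 k))))) ⟩
      F (v ∷ᵥ M) + 1# * F (v ∷ᵥ M) ≈⟨ +-congˡ (*-identityˡ _) ⟩
      F (v ∷ᵥ M) + F (v ∷ᵥ M)      ∎))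

    sum-head : ∀ {l} (x : Fin l → A) (W : Rows l m) (M : Rows n m) →
               F ((λ k → sum (λ j → x j * W j k)) ∷ᵥ M) ≈ sum (λ j → x j * F (W j ∷ᵥ M))
    sum-head {zero}  x W M = zero-head M λ _ → refl
    sum-head {suc l} x W M = begin
      F ((λ k → sum (λ j → x j * W j k)) ∷ᵥ M)
        ≈⟨ linear-head (x zero) M (λ k → +-comm _ _) ⟩
      F ((λ k → sum (λ j → x (suc j) * W (suc j) k)) ∷ᵥ M) + x zero * F (W zero ∷ᵥ M)
        ≈⟨ +-congʳ (sum-head (x ∘ suc) (W ∘ suc) M) ⟩
      sum (λ j → x (suc j) * F (W (suc j) ∷ᵥ M)) + x zero * F (W zero ∷ᵥ M)
        ≈⟨ +-comm _ _ ⟩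
      sum (λ j → x j * F (W j ∷ᵥ M)) ∎

  -- Polarization: the form vanishes on (s, s) with s = u + v, and expanding leaves the two mixed
  -- terms.
  swap-head : ∀ {n m} {F : Rows (suc (suc n)) m → A} → Alternating F → ∀ u v (M : Rows n m) →
              F (u ∷ᵥ v ∷ᵥ M) ≈ - F (v ∷ᵥ u ∷ᵥ M)
  swap-head {F = F} aF u v M = begin
    F (u ∷ᵥ v ∷ᵥ M)                                   ≈⟨ +-identityʳ _ ⟨
    F (u ∷ᵥ v ∷ᵥ M) + 0#                              ≈⟨ +-congˡ (-‿inverseʳ _) ⟨
    F (u ∷ᵥ v ∷ᵥ M) + (F (v ∷ᵥ u ∷ᵥ M) + - F (v ∷ᵥ u ∷ᵥ M)) ≈⟨ +-assoc _ _ _ ⟨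
    (F (u ∷ᵥ v ∷ᵥ M) + F (v ∷ᵥ u ∷ᵥ M)) + - F (v ∷ᵥ u ∷ᵥ M) ≈⟨ +-congʳ skew ⟩
    0# + - F (v ∷ᵥ u ∷ᵥ M)                            ≈⟨ +-identityˡ _ ⟩
    - F (v ∷ᵥ u ∷ᵥ M)                                 ∎
    where
    s : _
    s = λ k → u k + 1# * v k
    skew : F (u ∷ᵥ v ∷ᵥ M) + F (v ∷ᵥ u ∷ᵥ M) ≈ 0#
    skew = begin
      F (u ∷ᵥ v ∷ᵥ M) + F (v ∷ᵥ u ∷ᵥ M)
        ≈⟨ +-cong (trans (sym (+-identityˡ _)) (sym (+-cong (aF .adjacent here λ _ → refl) (*-identityˡ _))))
                  (trans (sym (+-identityʳ _)) (sym (+-congˡ (trans (*-identityˡ _) (aF .adjacent here λ _ → refl))))) ⟩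
      (F (u ∷ᵥ u ∷ᵥ M) + 1# * F (u ∷ᵥ v ∷ᵥ M)) + (F (v ∷ᵥ u ∷ᵥ M) + 1# * F (v ∷ᵥ v ∷ᵥ M))
        ≈⟨ +-cong (linear-head (multilinear-∷ (aF .multilinear) u) 1# M λ _ → refl)
                  (linear-head (multilinear-∷ (aF .multilinear) v) 1# M λ _ → refl) ⟨
      F (u ∷ᵥ s ∷ᵥ M) + F (v ∷ᵥ s ∷ᵥ M)
        ≈⟨ +-congˡ (*-identityˡ _) ⟨
      F (u ∷ᵥ s ∷ᵥ M) + 1# * F (v ∷ᵥ s ∷ᵥ M)
        ≈⟨ linear-head (aF .multilinear) 1# (s ∷ᵥ M) (λ _ → refl) ⟨
      F (s ∷ᵥ s ∷ᵥ M)
        ≈⟨ aF .adjacent here (λ _ → refl) ⟩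
      0# ∎

  sign : ℕ → A
  sign j = (- 1#) ^ j

  sign-square : ∀ j → sign j * sign j ≈ 1#
  sign-square zero    = *-identityˡ 1#
  sign-square (suc j) = begin
    (- 1# * sign j) * (- 1# * sign j) ≈⟨ *-cong (-1*x≈-x _) (-1*x≈-x _) ⟩
    (- sign j) * (- sign j)           ≈⟨ -‿distribˡ-* _ _ ⟨
    - (sign j * - sign j)             ≈⟨ -‿cong (-‿distribʳ-* _ _) ⟨
    - - (sign j * sign j)             ≈⟨ -‿involutive _ ⟩
    sign j * sign j                   ≈⟨ sign-square j ⟩
    1#                                ∎

  -- Row j passes the j rows before it, each exchange costing a sign. The induction freezes row 0
  -- and works with the form in the remaining rows.
  move-to-head : ∀ {n m} {F : Rows (suc n) m → A} → Alternating F → ∀ (M : Rows (suc n) m) j →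
                 F (M j ∷ᵥ M ∘ punchIn j) ≈ sign (toℕ j) * F M
  move-to-head aF M zero = trans (aF .multilinear .respects (λ i k → sym (uncons M i k))) (sym (*-identityˡ _))
  move-to-head {suc n} {F = F} aF M (suc j) = begin
    F (M (suc j) ∷ᵥ M ∘ punchIn (suc j))
      ≈⟨ aF .multilinear .respects (∷-cong (λ _ → refl) λ { zero k → refl ; (suc i) k → refl }) ⟩
    F (M (suc j) ∷ᵥ M zero ∷ᵥ M ∘ suc ∘ punchIn j)
      ≈⟨ swap-head aF _ _ _ ⟩
    - F (M zero ∷ᵥ M (suc j) ∷ᵥ M ∘ suc ∘ punchIn j)
      ≈⟨ -‿cong (move-to-head (alternating-∷ aF (M zero)) (M ∘ suc) j) ⟩
    - (sign (toℕ j) * F (M zero ∷ᵥ M ∘ suc))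
      ≈⟨ -‿cong (*-congˡ (aF .multilinear .respects (uncons M))) ⟨
    - (sign (toℕ j) * F M)
      ≈⟨ -1*x≈-x _ ⟨
    - 1# * (sign (toℕ j) * F M)
      ≈⟨ *-assoc _ _ _ ⟨
    sign (suc (toℕ j)) * F M ∎

  repeated-head : ∀ {n m} {F : Rows (suc n) m → A} → Alternating F → ∀ {v} (M : Rows n m) i →
                  M i ≈ᵥ v → F (v ∷ᵥ M) ≈ 0#
  repeated-head {suc n} {F = F} aF {v} M i Mi≈v = begin
    F (v ∷ᵥ M)                                          ≈⟨ *-identityˡ _ ⟨
    -- Inserting the square of the sign replaces dividing by it.
    1# * F (v ∷ᵥ M)                                     ≈⟨ *-congʳ (sign-square (toℕ i)) ⟨
    (sign (toℕ i) * sign (toℕ i)) * F (v ∷ᵥ M)          ≈⟨ *-assoc _ _ _ ⟩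
    sign (toℕ i) * (sign (toℕ i) * F (v ∷ᵥ M))          ≈⟨ *-congˡ (move-to-head (alternating-∷ aF v) M i) ⟨
    sign (toℕ i) * F (v ∷ᵥ M i ∷ᵥ M ∘ punchIn i)         ≈⟨ *-congˡ (aF .adjacent here (λ k → sym (Mi≈v k))) ⟩
    sign (toℕ i) * 0#                                  ≈⟨ zeroʳ _ ⟩
    0#                                                 ∎

  -- Rows are cleared one at a time, so the vanishing hypothesis ranges over all matrices, including
  -- those that mix cleared and uncleared rows. It serves to clear column j once `δ j` is the first
  -- row.
  add-multiples : ∀ {n m} {F : Rows n m → A} → Multilinear F → ∀ v → (∀ M i → M i ≈ᵥ v → F M ≈ 0#) →
                  ∀ (M : Rows n m) (x : Fin n → A) → F (λ i k → M i k + x i * v k) ≈ F M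
  add-multiples {zero}  mF v vanish M x = mF .respects λ ()
  add-multiples {suc n} {F = F} mF v vanish M x = begin
    F M′                                          ≈⟨ mF .respects (uncons M′) ⟩
    F (M′ zero ∷ᵥ M′ ∘ suc)                        ≈⟨ linear-head mF (x zero) (M′ ∘ suc) (λ _ → refl) ⟩
    F (M zero ∷ᵥ M′ ∘ suc) + x zero * F (v ∷ᵥ M′ ∘ suc)
      ≈⟨ +-cong (add-multiples (multilinear-∷ mF (M zero)) v (λ N i → vanish (M zero ∷ᵥ N) (suc i)) (M ∘ suc) (x ∘ suc))
                (trans (*-congˡ (vanish (v ∷ᵥ M′ ∘ suc) zero λ _ → refl)) (zeroʳ _)) ⟩
    F (M zero ∷ᵥ M ∘ suc) + 0#                     ≈⟨ +-identityʳ _ ⟩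
    F (M zero ∷ᵥ M ∘ suc)                          ≈⟨ mF .respects (uncons M) ⟨
    F M                                           ∎
    where M′ = λ i k → M i k + x i * v k

  minor : ∀ {n} → Rows n (suc n) → Fin (suc n) → Matrix n
  minor M j i k = M i (punchIn j k)

  -- Replacing row 0 by a combination of the unit rows δ j and clearing column j
  -- of the other rows turns F into the Laplace expansion that defines det.
  det-unique : ∀ {n} {F : Rows n n → A} → Alternating F → ∀ M → F M ≈ det M * F δ
  det-unique {zero} aF M = trans (aF .multilinear .respects λ ()) (sym (*-identityˡ _))
  det-unique {suc n} {F} aF M = begin
    F M
      ≈⟨ aF .multilinear .respects (λ { zero k → sym (sum-δ (M zero) k) ; (suc i) k → refl }) ⟩
    F ((λ k → sum (λ j → M zero j * δ j k)) ∷ᵥ M ∘ suc)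
      ≈⟨ sum-head (aF .multilinear) (M zero) δ (M ∘ suc) ⟩
    sum (λ j → M zero j * F (δ j ∷ᵥ M ∘ suc))
      ≈⟨ sum-cong-≋ term ⟩
    sum (λ j → (sign (toℕ j) * (M zero j * det (minor (M ∘ suc) j))) * F δ)
      ≈⟨ *-distribʳ-sum (F δ) (λ j → sign (toℕ j) * (M zero j * det (minor (M ∘ suc) j))) ⟨
    det M * F δ ∎
    where
    -- Right multiplication by `pad j` reinserts a zero column at position j, embedding the minor
    -- back.
    pad : ∀ j → Rows n (suc n)
    pad j = δ ∘ punchIn j
    split : ∀ j i k → M (suc i) k ≈ (minor (M ∘ suc) j · pad j) i k + M (suc i) j * δ j k
    split j i k = begin
      M (suc i) k                                                       ≈⟨ sum-δ (M (suc i)) k ⟨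
      sum (λ l → M (suc i) l * δ l k)                                   ≈⟨ sum-remove {i = j} (λ l → M (suc i) l * δ l k) ⟩
      M (suc i) j * δ j k + (minor (M ∘ suc) j · pad j) i k              ≈⟨ +-comm _ _ ⟩
      (minor (M ∘ suc) j · pad j) i k + M (suc i) j * δ j k              ∎
    identity : ∀ j i k → (δ · pad j) i k ≈ δ (punchIn j i) k
    identity j i k = trans (sum-cong-≋ λ l → trans (*-comm _ _) (*-congˡ (δ-sym i l)))
                           (sum-δ (λ l → δ (punchIn j l) k) i)
    cofactor : ∀ j → F (δ j ∷ᵥ M ∘ suc) ≈ det (minor (M ∘ suc) j) * (sign (toℕ j) * F δ)
    cofactor j = begin
      F (δ j ∷ᵥ M ∘ suc)
        ≈⟨ aF .multilinear .respects (∷-cong (λ _ → refl) (split j)) ⟩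
      F (δ j ∷ᵥ λ i k → (minor (M ∘ suc) j · pad j) i k + M (suc i) j * δ j k)
        ≈⟨ add-multiples (multilinear-∷ (aF .multilinear) (δ j)) (δ j) (repeated-head aF) (minor (M ∘ suc) j · pad j) (λ i → M (suc i) j) ⟩
      F (δ j ∷ᵥ minor (M ∘ suc) j · pad j)
        ≈⟨ det-unique (alternating-· (alternating-∷ aF (δ j)) (pad j)) (minor (M ∘ suc) j) ⟩
      det (minor (M ∘ suc) j) * F (δ j ∷ᵥ δ · pad j)
        ≈⟨ *-congˡ (aF .multilinear .respects (∷-cong (λ _ → refl) (identity j))) ⟩
      det (minor (M ∘ suc) j) * F (δ j ∷ᵥ δ ∘ punchIn j)
        ≈⟨ *-congˡ (move-to-head aF δ j) ⟩
      det (minor (M ∘ suc) j) * (sign (toℕ j) * F δ) ∎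
    term : ∀ j → M zero j * F (δ j ∷ᵥ M ∘ suc) ≈ (sign (toℕ j) * (M zero j * det (minor (M ∘ suc) j))) * F δ
    term j = begin
      M zero j * F (δ j ∷ᵥ M ∘ suc)                                ≈⟨ *-congˡ (cofactor j) ⟩
      M zero j * (det (minor (M ∘ suc) j) * (sign (toℕ j) * F δ)) ≈⟨ *-assoc _ _ _ ⟨
      (M zero j * det (minor (M ∘ suc) j)) * (sign (toℕ j) * F δ) ≈⟨ x∙yz≈y∙xz _ _ _ ⟩
      sign (toℕ j) * ((M zero j * det (minor (M ∘ suc) j)) * F δ) ≈⟨ *-assoc _ _ _ ⟨
      (sign (toℕ j) * (M zero j * det (minor (M ∘ suc) j))) * F δ ∎

  det-cong : ∀ {n} {M N : Matrix n} → M ≈ᵣ N → det M ≈ det N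
  det-cong {zero}  M≈N = refl
  det-cong {suc n} M≈N = sum-cong-≋ λ j →
    *-congˡ {sign (toℕ j)} (*-cong (M≈N zero j) (det-cong λ i k → M≈N (suc i) (punchIn j k)))

  transpose : ∀ {n} → Matrix n → Matrix n
  transpose M i k = M k i

  -- Each term of the expansion meets column p exactly once: through its entry if p is the deleted
  -- column, otherwise through its minor, where induction applies.
  det-linear-column : ∀ {n} (p : Fin n) x {L M N : Matrix n} → (∀ i → L i p ≈ M i p + x * N i p) →
    (∀ {q} → q ≢ p → ∀ i → L i q ≈ M i q) → (∀ {q} → q ≢ p → ∀ i → L i q ≈ N i q) →
    det L ≈ det M + x * det N
  det-linear-column {suc n} p x {L} {M} {N} eq L≈M L≈N = begin
    det L                                                                    ≈⟨ sum-cong-≋ term ⟩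
    sum (λ j → t M j + x * t N j)                                            ≈⟨ sum-linear x (t M) (t N) ⟩
    det M + x * det N                                                        ∎
    where
    t : Matrix (suc n) → Fin (suc n) → A
    t K j = sign (toℕ j) * (K zero j * det (minor (K ∘ suc) j))
    expand : ∀ s y z → s * (y + x * z) ≈ s * y + x * (s * z)
    expand s y z = trans (distribˡ _ _ _) (+-congˡ (x∙yz≈y∙xz _ _ _))
    term : ∀ j → t L j ≈ t M j + x * t N j
    term j with j ≟ p
    ... | yes ≡.refl = trans (*-congˡ (begin
      L zero j * det (minor (L ∘ suc) j)
        ≈⟨ *-cong (eq zero) (det-cong λ i k → L≈M (punchInᵢ≢i j k) (suc i)) ⟩
      (M zero j + x * N zero j) * det (minor (M ∘ suc) j)
        ≈⟨ distribʳ _ _ _ ⟩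
      M zero j * det (minor (M ∘ suc) j) + (x * N zero j) * det (minor (M ∘ suc) j)
        ≈⟨ +-congˡ (*-assoc _ _ _) ⟩
      M zero j * det (minor (M ∘ suc) j) + x * (N zero j * det (minor (M ∘ suc) j))
        ≈⟨ +-congˡ (*-congˡ (*-congˡ (det-cong λ i k →
             trans (sym (L≈M (punchInᵢ≢i j k) (suc i))) (L≈N (punchInᵢ≢i j k) (suc i))))) ⟩
      M zero j * det (minor (M ∘ suc) j) + x * (N zero j * det (minor (N ∘ suc) j)) ∎))
      (expand _ _ _)
    ... | no j≢p = trans (*-congˡ (begin
      L zero j * det (minor (L ∘ suc) j)
        ≈⟨ *-congˡ (det-linear-column (punchOut j≢p) x
             at
             (λ q≢ i → L≈M (q≢ ∘ hits) (suc i))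
             (λ q≢ i → L≈N (q≢ ∘ hits) (suc i))) ⟩
      L zero j * (det (minor (M ∘ suc) j) + x * det (minor (N ∘ suc) j))
        ≈⟨ distribˡ _ _ _ ⟩
      L zero j * det (minor (M ∘ suc) j) + L zero j * (x * det (minor (N ∘ suc) j))
        ≈⟨ +-cong (*-congʳ (L≈M j≢p zero)) (trans (x∙yz≈y∙xz _ _ _) (*-congˡ (*-congʳ (L≈N j≢p zero)))) ⟩
      M zero j * det (minor (M ∘ suc) j) + x * (N zero j * det (minor (N ∘ suc) j)) ∎))
      (expand _ _ _)
      where
      hits : ∀ {q} → punchIn j q ≡ p → q ≡ punchOut j≢p
      hits {q} e = punchIn-injective j q _ (≡.trans e (≡.sym (punchIn-punchOut j≢p)))
      at : ∀ i → minor (L ∘ suc) j i (punchOut j≢p)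
               ≈ minor (M ∘ suc) j i (punchOut j≢p) + x * minor (N ∘ suc) j i (punchOut j≢p)
      at i rewrite punchIn-punchOut j≢p = eq (suc i)

  sign-adjacent : ∀ {n} {p q : Fin n} → Adjacent p q → sign (toℕ q) ≈ - sign (toℕ p)
  sign-adjacent here        = -1*x≈-x _
  sign-adjacent (there adj) = trans (*-congˡ (sign-adjacent adj)) (sym (-‿distribʳ-* _ _))

  sum-cancel : ∀ {n} {p q : Fin n} → Adjacent p q → (f : Fin n → A) →
    (∀ j → j ≢ p → j ≢ q → f j ≈ 0#) → f q ≈ - f p → sum f ≈ 0#
  sum-cancel here f f≈0 fq = begin
    sum f                                         ≈⟨ +-congˡ (+-cong fq (sum≈0 (λ j → f (suc (suc j))) λ j → f≈0 (suc (suc j)) (λ ()) (λ ()))) ⟩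
    f zero + (- f zero + 0#)                      ≈⟨ +-congˡ (+-identityʳ _) ⟩
    f zero + - f zero                             ≈⟨ -‿inverseʳ _ ⟩
    0#                                            ∎
  sum-cancel (there adj) f f≈0 fq = begin
    f zero + sum (f ∘ suc) ≈⟨ +-cong (f≈0 zero (λ ()) (λ ()))
                                     (sum-cancel adj (f ∘ suc) (λ j j≢p j≢q → f≈0 (suc j) (j≢p ∘ suc-injective) (j≢q ∘ suc-injective)) fq) ⟩
    0# + 0#                ≈⟨ +-identityˡ _ ⟩
    0#                     ∎

  -- If the deleted column lies outside the pair, the minor keeps two equal adjacent columns. The
  -- two remaining terms have equal entries and equal minors but opposite signs.
  det-adjacent-columns : ∀ {n} {p q : Fin n} → Adjacent p q → ∀ {M : Matrix n} → (∀ i → M i p ≈ M i q) → det M ≈ 0#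
  det-adjacent-columns {suc n} {p} {q} adj {M} Mp≈Mq = sum-cancel adj _ off on
    where
    off : ∀ j → j ≢ p → j ≢ q → sign (toℕ j) * (M zero j * det (minor (M ∘ suc) j)) ≈ 0#
    off j j≢p j≢q with avoidance adj j
    ... | left eq  = contradiction eq j≢p
    ... | right eq = contradiction eq j≢q
    ... | avoids p′ q′ adj′ ≡.refl ≡.refl =
      trans (*-congˡ (trans (*-congˡ (det-adjacent-columns adj′ (Mp≈Mq ∘ suc))) (zeroʳ _))) (zeroʳ _)
    same : minor (M ∘ suc) q ≈ᵣ minor (M ∘ suc) p
    same i k with punchIn-adjacent adj k
    ... | inj₁ eq rewrite eq = refl
    ... | inj₂ (eqp , eqq) rewrite eqp | eqq = Mp≈Mq (suc i)
    on : sign (toℕ q) * (M zero q * det (minor (M ∘ suc) q)) ≈ - (sign (toℕ p) * (M zero p * det (minor (M ∘ suc) p)))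
    on = trans (*-cong (sign-adjacent adj) (*-cong (sym (Mp≈Mq zero)) (det-cong same))) (sym (-‿distribˡ-* _ _))

  det-transpose-alternating : ∀ {n} → Alternating {n} (det ∘ transpose)
  det-transpose-alternating .multilinear .respects M≈N = det-cong λ i k → M≈N k i
  det-transpose-alternating .multilinear .linear i x {L} {M} {N} =
    det-linear-column i x {transpose L} {transpose M} {transpose N}
  det-transpose-alternating .adjacent adj {M} = det-adjacent-columns adj {transpose M}

  det-lower : ∀ {n} (M : Matrix n) → (∀ {i k} → i < k → M i k ≈ 0#) → det M ≈ ∏ (λ i → M i i)
  det-lower {zero}  M M≈0 = refl
  det-lower {suc n} M M≈0 = begin
    det M
      ≈⟨ +-cong (trans (*-identityˡ _) (*-congˡ (det-lower (λ i k → M (suc i) (suc k)) (M≈0 ∘ s≤s))))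
                (sum≈0 {n} _ λ j → trans (*-congˡ (trans (*-congʳ (M≈0 {zero} {suc j} (s≤s z≤n))) (zeroˡ _))) (zeroʳ _)) ⟩
    ∏ (λ i → M i i) + 0#
      ≈⟨ +-identityʳ _ ⟩
    ∏ (λ i → M i i) ∎

  ∏≈1 : ∀ {n} (f : Fin n → A) → (∀ i → f i ≈ 1#) → ∏ f ≈ 1#
  ∏≈1 {zero}  f f≈1 = refl
  ∏≈1 {suc n} f f≈1 = trans (*-cong (f≈1 zero) (∏≈1 (f ∘ suc) (f≈1 ∘ suc))) (*-identityˡ 1#)

  δ-< : ∀ {n} {i k : Fin n} → i < k → δ i k ≈ 0#
  δ-< {i = zero}  {suc k} _         = refl
  δ-< {i = suc i} {suc k} (s≤s i<k) = δ-< i<k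

  det-δ : ∀ {n} → det (δ {n}) ≈ 1#
  det-δ {n} = trans (det-lower {n} δ δ-<) (∏≈1 {n} _ δ-diag)

  -- `det ∘ transpose` alternates in the rows because `det` alternates in the columns, so
  -- `det-unique` fixes it by its value at the identity.
  det-transpose : ∀ {n} (M : Matrix n) → det (transpose M) ≈ det M
  det-transpose {n} M = begin
    det (transpose M)         ≈⟨ det-unique det-transpose-alternating M ⟩
    det M * det (transpose (δ {n})) ≈⟨ *-congˡ (det-cong {n} λ i k → δ-sym k i) ⟩
    det M * det (δ {n})       ≈⟨ *-congˡ (det-δ {n}) ⟩
    det M * 1#                ≈⟨ *-identityʳ _ ⟩
    det M                     ∎

  det-upper : ∀ {n} (M : Matrix n) → (∀ {i k} → k < i → M i k ≈ 0#) → det M ≈ ∏ (λ i → M i i)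
  det-upper M M≈0 = trans (sym (det-transpose M)) (det-lower (transpose M) M≈0)

  -- Transposition invariance makes `det` itself alternate in the rows. As a function of M,
  -- `det (M · N)` is then such a form too, with value `det N` at the identity.
  det-· : ∀ {n} (M N : Matrix n) → det (M · N) ≈ det M * det N
  det-· M N = trans
    (det-unique (alternating-· (alternating-resp det-transpose det-transpose-alternating) N) M)
    (*-congˡ (det-cong λ i k → trans (sum-cong-≋ λ j → trans (*-comm _ _) (*-congˡ (δ-sym i j))) (sum-δ (λ j → N j k) i)))

-- Symmetry of trinomial coefficients.

nCk*k![n∸k]!≡n! : ∀ {n k} → k ≤ n → (n C k) ℕ.* (k ! ℕ.* (n ∸ k) !) ≡ n !
nCk*k![n∸k]!≡n! {n} {k} k≤n =
  ≡.trans (≡.cong (ℕ._* (k ! ℕ.* (n ∸ k) !)) (nCk≡n!/k![n-k]! k≤n))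
          (m/n*n≡m {{k ℕ.!* (n ∸ k) !≢0}} (k![n∸k]!∣n! k≤n))

∸-∸-comm : ∀ n k q → n ∸ k ∸ q ≡ n ∸ q ∸ k
∸-∸-comm n k q = ≡.trans (ℕ.∸-+-assoc n k q) (≡.trans (≡.cong (n ∸_) (ℕ.+-comm k q)) (≡.sym (ℕ.∸-+-assoc n q k)))

trinomial-! : ∀ {n k q} → k ≤ n → q ≤ n ∸ k →
  ((n C k) ℕ.* ((n ∸ k) C q)) ℕ.* (k ! ℕ.* (q ! ℕ.* (n ∸ k ∸ q) !)) ≡ n !
trinomial-! {n} {k} {q} k≤n q≤n∸k = begin
  ((n C k) ℕ.* ((n ∸ k) C q)) ℕ.* (k ! ℕ.* (q ! ℕ.* (n ∸ k ∸ q) !))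
    ≡⟨ interchange (n C k) _ (k !) _ ⟩
  ((n C k) ℕ.* k !) ℕ.* (((n ∸ k) C q) ℕ.* (q ! ℕ.* (n ∸ k ∸ q) !))
    ≡⟨ ≡.cong (((n C k) ℕ.* k !) ℕ.*_) (nCk*k![n∸k]!≡n! q≤n∸k) ⟩
  ((n C k) ℕ.* k !) ℕ.* (n ∸ k) !
    ≡⟨ ℕ.*-assoc (n C k) (k !) _ ⟩
  (n C k) ℕ.* (k ! ℕ.* (n ∸ k) !)
    ≡⟨ nCk*k![n∸k]!≡n! k≤n ⟩
  n ! ∎
  where
  open ≡.≡-Reasoning
  open CommutativeSemigroupProperties ℕ.*-commutativeSemigroup using (interchange)

-- For k + q ≤ n, multiplying by k! q! (n - k - q)! turns both sides into n!. Beyond that range both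
-- sides vanish.
trinomial-sym : ∀ {n k q} → k ≤ n → q ≤ n → (n C k) ℕ.* ((n ∸ k) C q) ≡ (n C q) ℕ.* ((n ∸ q) C k)
trinomial-sym {n} {k} {q} k≤n q≤n with q ℕ.≤? n ∸ k
... | yes q≤n∸k = ℕ.*-cancelʳ-≡ _ _ (k ! ℕ.* (q ! ℕ.* (n ∸ k ∸ q) !)) {{nonZero}} (begin
  ((n C k) ℕ.* ((n ∸ k) C q)) ℕ.* (k ! ℕ.* (q ! ℕ.* (n ∸ k ∸ q) !)) ≡⟨ trinomial-! k≤n q≤n∸k ⟩
  n !                                                               ≡⟨ trinomial-! q≤n k≤n∸q ⟨
  ((n C q) ℕ.* ((n ∸ q) C k)) ℕ.* (q ! ℕ.* (k ! ℕ.* (n ∸ q ∸ k) !)) ≡⟨ ≡.cong (((n C q) ℕ.* ((n ∸ q) C k)) ℕ.*_) (x∙yz≈y∙xz (q !) (k !) _) ⟩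
  ((n C q) ℕ.* ((n ∸ q) C k)) ℕ.* (k ! ℕ.* (q ! ℕ.* (n ∸ q ∸ k) !)) ≡⟨ ≡.cong (λ m → ((n C q) ℕ.* ((n ∸ q) C k)) ℕ.* (k ! ℕ.* (q ! ℕ.* m !))) (∸-∸-comm n q k) ⟩
  ((n C q) ℕ.* ((n ∸ q) C k)) ℕ.* (k ! ℕ.* (q ! ℕ.* (n ∸ k ∸ q) !)) ∎)
  where
  open ≡.≡-Reasoning
  open CommutativeSemigroupProperties ℕ.*-commutativeSemigroup using (x∙yz≈y∙xz)
  k≤n∸q : k ≤ n ∸ q
  k≤n∸q = ℕ.m+n≤o⇒m≤o∸n k (≡.subst (k ℕ.+ q ≤_) (ℕ.m+[n∸m]≡n k≤n) (ℕ.+-monoʳ-≤ k q≤n∸k))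
  nonZero : NonZero (k ! ℕ.* (q ! ℕ.* (n ∸ k ∸ q) !))
  nonZero = ℕ.m*n≢0 _ _ {{k ℕ.!≢0}} {{q ℕ.!* (n ∸ k ∸ q) !≢0}}
... | no q≰n∸k = begin
  (n C k) ℕ.* ((n ∸ k) C q) ≡⟨ ≡.cong ((n C k) ℕ.*_) (k>n⇒nCk≡0 (ℕ.≰⇒> q≰n∸k)) ⟩
  (n C k) ℕ.* 0             ≡⟨ ℕ.*-zeroʳ (n C k) ⟩
  0                         ≡⟨ ℕ.*-zeroʳ (n C q) ⟨
  (n C q) ℕ.* 0             ≡⟨ ≡.cong ((n C q) ℕ.*_) (k>n⇒nCk≡0 (ℕ.≰⇒> k≰n∸q)) ⟨
  (n C q) ℕ.* ((n ∸ q) C k) ∎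
  where
  open ≡.≡-Reasoning
  k≰n∸q : ℕ._≰_ k (n ∸ q)
  k≰n∸q k≤n∸q = q≰n∸k (ℕ.m+n≤o⇒m≤o∸n q (≡.subst (q ℕ.+ k ≤_) (ℕ.m+[n∸m]≡n q≤n) (ℕ.+-monoʳ-≤ q k≤n∸q)))

-- Reversed and lexicographic order of indices.

opposite-anti-< : ∀ {n} {i k : Fin n} → i < k → opposite k < opposite i
opposite-anti-< {n} {i} {k} i<k = ≡.subst₂ ℕ._<_ (≡.sym (opposite-prop k)) (≡.sym (opposite-prop i))
  (ℕ.∸-monoʳ-< (s≤s i<k) (toℕ<n k))

toℕ+suc-opposite : ∀ {n} (i : Fin n) → toℕ i ℕ.+ suc (toℕ (opposite i)) ≡ n
toℕ+suc-opposite {n} i = ≡.trans (ℕ.+-suc (toℕ i) _)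
  (≡.trans (≡.cong (suc (toℕ i) ℕ.+_) (opposite-prop i)) (ℕ.m+[n∸m]≡n (toℕ<n i)))

<-lexicographic : ∀ {m} n (p q : Fin (m ℕ.* n)) → p < q →
  quotient {m} n p < quotient {m} n q ⊎
  (quotient {m} n p ≡ quotient {m} n q × remainder {m} n p < remainder {m} n q)
<-lexicographic {m} n p q p<q = helper (remQuot {m} n p) (remQuot {m} n q)
    (≡.subst₂ _<_ (≡.sym (combine-remQuot {m} n p)) (≡.sym (combine-remQuot {m} n q)) p<q)
  where
  helper : ((i , j) (k , l) : Fin m × Fin n) → combine i j < combine k l → i < k ⊎ (i ≡ k × j < l)
  helper (i , j) (k , l) ij<kl with <-cmp i k
  ... | tri< i<k _ _ = inj₁ i<k
  ... | tri> _ _ k<i = contradiction ij<kl (ℕ.<-asym (combine-monoˡ-< l j k<i))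
  ... | tri≈ _ ≡.refl _ = inj₂ (≡.refl , ℕ.+-cancelˡ-< (n ℕ.* toℕ i) (toℕ j) (toℕ l)
          (≡.subst₂ ℕ._<_ (toℕ-combine i j) (toℕ-combine i l) ij<kl))

-- Iterated sums in a commutative monoid, applied to both addition and multiplication.

module SumProperties {a ℓ} (M : CommutativeMonoid a ℓ) where

  open CommutativeMonoid M
  open MonoidSum M using (sum)

  sum-↑ : ∀ m {n} (f : Fin (m ℕ.+ n) → Carrier) → sum f ≈ sum (λ i → f (i ↑ˡ n)) ∙ sum (λ i → f (m ↑ʳ i))
  sum-↑ zero    f = sym (identityˡ _)
  sum-↑ (suc m) f = trans (∙-congˡ (sum-↑ m (f ∘ suc))) (sym (assoc _ _ _))

  sum-combine : ∀ m n (f : Fin (m ℕ.* n) → Carrier) → sum f ≈ sum (λ i → sum (λ j → f (combine {m} {n} i j)))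
  sum-combine zero    n f = refl
  sum-combine (suc m) n f = trans (sum-↑ n f) (∙-congˡ (sum-combine m n (f ∘ (n ↑ʳ_))))

-- Coefficients of products of linear factors.

module LinearFactors {c ℓ} (R : CommutativeRing c ℓ) where

  open CommutativeRing R hiding (zero) renaming (Carrier to A)
  open Exp commutativeSemiring using (_^_)
  open Mult semiring using (×-congʳ; ×-congˡ; ×-homo-+; ×-comm-*; ×-assoc-*; ×-assocˡ; ×-homo-1) renaming (_×_ to _·ℕ_)
  open SemiringSum semiring using (sum; sum-cong-≋; ∑-distrib-+)
  open DeterminantProperties R using (sum≈0; sum-linear)
  open CommutativeSemigroupProperties *-commutativeSemigroup using (x∙yz≈y∙xz)
  open SetoidReasoning setoid

  -- Multiplication by x on coefficient sequences.
  shift : (ℕ → A) → ℕ → A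
  shift f zero    = 0#
  shift f (suc k) = f k

  -- coefficient k of the polynomial ∏_{c ∈ cs} (x + c)
  ∏[x+_] : List A → ℕ → A
  ∏[x+ []     ] zero    = 1#
  ∏[x+ []     ] (suc _) = 0#
  ∏[x+ c ∷ cs ] k       = c * ∏[x+ cs ] k + shift ∏[x+ cs ] k

  shift-cong : ∀ {f g} → (∀ k → f k ≈ g k) → ∀ k → shift f k ≈ shift g k
  shift-cong f≈g zero    = refl
  shift-cong f≈g (suc k) = f≈g k

  ∏[x+]-cong : ∀ {cs ds} → Pointwise _≈_ cs ds → ∀ k → ∏[x+ cs ] k ≈ ∏[x+ ds ] k
  ∏[x+]-cong []         k = refl
  ∏[x+]-cong (c≈d ∷ eq) k = +-cong (*-cong c≈d (∏[x+]-cong eq k)) (shift-cong (∏[x+]-cong eq) k)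

  ∏[x+]-degree : ∀ cs {k} → length cs ℕ.< k → ∏[x+ cs ] k ≈ 0#
  ∏[x+]-degree []       {suc k} _ = refl
  ∏[x+]-degree (c ∷ cs) {suc k} (s≤s lt) = begin
    c * ∏[x+ cs ] (suc k) + ∏[x+ cs ] k ≈⟨ +-cong (*-congˡ (∏[x+]-degree cs (ℕ.m<n⇒m<1+n lt))) (∏[x+]-degree cs lt) ⟩
    c * 0# + 0#                         ≈⟨ +-identityʳ _ ⟩
    c * 0#                              ≈⟨ zeroʳ c ⟩
    0#                                  ∎

  ∏[x+]-monic : ∀ cs → ∏[x+ cs ] (length cs) ≈ 1#
  ∏[x+]-monic []       = refl
  ∏[x+]-monic (c ∷ cs) = begin
    c * ∏[x+ cs ] (suc (length cs)) + ∏[x+ cs ] (length cs)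
      ≈⟨ +-cong (trans (*-congˡ (∏[x+]-degree cs (ℕ.n<1+n _))) (zeroʳ c)) (∏[x+]-monic cs) ⟩
    0# + 1# ≈⟨ +-identityˡ 1# ⟩
    1#      ∎

  sum-last : ∀ n (f : ℕ → A) → sum {suc n} (f ∘ toℕ) ≈ sum {n} (f ∘ toℕ) + f n
  sum-last zero    f = +-comm _ _
  sum-last (suc n) f = trans (+-congˡ (sum-last n (f ∘ suc))) (sym (+-assoc _ _ _))

  -- Moves the factor y + c from the coefficients f onto the sequence g paired with them; `f n ≈ 0#`
  -- kills the boundary term `f n * g (suc n)`.
  sum-by-parts : ∀ n c (f g : ℕ → A) → f n ≈ 0# →
    sum {suc n} (λ m → (c * f (toℕ m) + shift f (toℕ m)) * g (toℕ m))
      ≈ sum {suc n} (λ m → f (toℕ m) * (c * g (toℕ m) + g (suc (toℕ m))))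
  sum-by-parts n c f g fn≈0 = begin
    sum {suc n} (λ m → (c * f (toℕ m) + shift f (toℕ m)) * g (toℕ m))
      ≈⟨ sum-cong-≋ {suc n} (λ m → trans (distribʳ (g (toℕ m)) _ (shift f (toℕ m))) (+-congʳ (*-assoc c (f (toℕ m)) _))) ⟩
    sum {suc n} (λ m → c * (f (toℕ m) * g (toℕ m)) + shift f (toℕ m) * g (toℕ m))
      ≈⟨ ∑-distrib-+ {suc n} (λ m → c * (f (toℕ m) * g (toℕ m))) (λ m → shift f (toℕ m) * g (toℕ m)) ⟩
    sum {suc n} (λ m → c * (f (toℕ m) * g (toℕ m))) + sum {suc n} (λ m → shift f (toℕ m) * g (toℕ m))
      ≈⟨ +-congˡ shifted ⟩
    sum {suc n} (λ m → c * (f (toℕ m) * g (toℕ m))) + sum {suc n} (λ m → f (toℕ m) * g (suc (toℕ m)))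
      ≈⟨ ∑-distrib-+ {suc n} (λ m → c * (f (toℕ m) * g (toℕ m))) (λ m → f (toℕ m) * g (suc (toℕ m))) ⟨
    sum {suc n} (λ m → c * (f (toℕ m) * g (toℕ m)) + f (toℕ m) * g (suc (toℕ m)))
      ≈⟨ sum-cong-≋ {suc n} (λ m → trans (+-congʳ (x∙yz≈y∙xz c (f (toℕ m)) (g (toℕ m)))) (sym (distribˡ (f (toℕ m)) _ (g (suc (toℕ m)))))) ⟩
    sum {suc n} (λ m → f (toℕ m) * (c * g (toℕ m) + g (suc (toℕ m)))) ∎
    where
    shifted : sum {suc n} (λ m → shift f (toℕ m) * g (toℕ m)) ≈ sum {suc n} (λ m → f (toℕ m) * g (suc (toℕ m)))
    shifted = begin
      0# * g 0 + sum {n} (λ m → f (toℕ m) * g (suc (toℕ m)))        ≈⟨ +-congʳ (zeroˡ _) ⟩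
      0# + sum {n} (λ m → f (toℕ m) * g (suc (toℕ m)))              ≈⟨ +-comm _ _ ⟩
      sum {n} (λ m → f (toℕ m) * g (suc (toℕ m))) + 0#              ≈⟨ +-congˡ (trans (*-congʳ fn≈0) (zeroˡ _)) ⟨
      sum {n} (λ m → f (toℕ m) * g (suc (toℕ m))) + f n * g (suc n) ≈⟨ sum-last n (λ m → f m * g (suc m)) ⟨
      sum {suc n} (λ m → f (toℕ m) * g (suc (toℕ m)))               ∎

  -- Substitution of x + b for y in P(y) = ∏_{c ∈ cs} (y + c), times ∏_{d ∈ ds} (x + d).
  ∏[x+]-substitute : ∀ b cs ds n → length cs ℕ.< n → ∀ k →
    sum {n} (λ m → ∏[x+ cs ] (toℕ m) * ∏[x+ replicate (toℕ m) b ++ ds ] k) ≈ ∏[x+ map (b +_) cs ++ ds ] k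
  ∏[x+]-substitute b [] ds (suc n) _ k = begin
    1# * ∏[x+ ds ] k + sum {n} (λ m → 0# * ∏[x+ replicate (suc (toℕ m)) b ++ ds ] k)
      ≈⟨ +-cong (*-identityˡ _) (sum≈0 {n} _ (λ m → zeroˡ _)) ⟩
    ∏[x+ ds ] k + 0# ≈⟨ +-identityʳ _ ⟩
    ∏[x+ ds ] k      ∎
  ∏[x+]-substitute b (c ∷ cs) ds (suc n) (s≤s lt) k = begin
    sum {suc n} (λ m → ∏[x+ c ∷ cs ] (toℕ m) * g (toℕ m) k)
      ≈⟨ sum-by-parts n c ∏[x+ cs ] (λ m → g m k) (∏[x+]-degree cs lt) ⟩
    sum {suc n} (λ m → ∏[x+ cs ] (toℕ m) * (c * g (toℕ m) k + (b * g (toℕ m) k + shift (g (toℕ m)) k)))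
      ≈⟨ sum-cong-≋ {suc n} (λ m → collect (∏[x+ cs ] (toℕ m)) (g (toℕ m) k) (shift (g (toℕ m)) k)) ⟩
    sum {suc n} (λ m → ∏[x+ cs ] (toℕ m) * shift (g (toℕ m)) k + (b + c) * (∏[x+ cs ] (toℕ m) * g (toℕ m) k))
      ≈⟨ sum-linear {suc n} (b + c) (λ m → ∏[x+ cs ] (toℕ m) * shift (g (toℕ m)) k) (λ m → ∏[x+ cs ] (toℕ m) * g (toℕ m) k) ⟩
    sum {suc n} (λ m → ∏[x+ cs ] (toℕ m) * shift (g (toℕ m)) k) + (b + c) * sum {suc n} (λ m → ∏[x+ cs ] (toℕ m) * g (toℕ m) k)
      ≈⟨ +-cong (shifted k) (*-congˡ (∏[x+]-substitute b cs ds (suc n) (ℕ.m<n⇒m<1+n lt) k)) ⟩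
    shift ∏[x+ map (b +_) cs ++ ds ] k + (b + c) * ∏[x+ map (b +_) cs ++ ds ] k
      ≈⟨ +-comm _ _ ⟩
    ∏[x+ map (b +_) (c ∷ cs) ++ ds ] k ∎
    where
    g : ℕ → ℕ → A
    g m = ∏[x+ replicate m b ++ ds ]
    collect : ∀ u v w → u * (c * v + (b * v + w)) ≈ u * w + (b + c) * (u * v)
    collect u v w = begin
      u * (c * v + (b * v + w))   ≈⟨ *-congˡ (+-assoc _ _ _) ⟨
      u * ((c * v + b * v) + w)   ≈⟨ *-congˡ (+-congʳ (trans (+-comm _ _) (sym (distribʳ v b c)))) ⟩
      u * ((b + c) * v + w)       ≈⟨ *-congˡ (+-comm _ _) ⟩
      u * (w + (b + c) * v)       ≈⟨ distribˡ _ _ _ ⟩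
      u * w + u * ((b + c) * v)   ≈⟨ +-congˡ (x∙yz≈y∙xz _ _ _) ⟩
      u * w + (b + c) * (u * v)   ∎
    shifted : ∀ k → sum {suc n} (λ m → ∏[x+ cs ] (toℕ m) * shift (g (toℕ m)) k) ≈ shift ∏[x+ map (b +_) cs ++ ds ] k
    shifted zero    = sum≈0 {suc n} _ (λ m → zeroʳ (∏[x+ cs ] (toℕ m)))
    shifted (suc k) = ∏[x+]-substitute b cs ds (suc n) (ℕ.m<n⇒m<1+n lt) k

  -- The vanishing factor will arise as `a i - a i`, which is zero only up to `≈`.
  module _ {c} (c≈0 : c ≈ 0#) where

    order-replicate : ∀ m cs {k} → k ℕ.< m → ∏[x+ replicate m c ++ cs ] k ≈ 0#
    order-replicate (suc m) cs {zero}  _        = trans (+-congʳ (trans (*-congʳ c≈0) (zeroˡ _))) (+-identityˡ _)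
    order-replicate (suc m) cs {suc k} (s≤s lt) = begin
      c * ∏[x+ replicate m c ++ cs ] (suc k) + ∏[x+ replicate m c ++ cs ] k
        ≈⟨ +-cong (trans (*-congʳ c≈0) (zeroˡ _)) (order-replicate m cs lt) ⟩
      0# + 0# ≈⟨ +-identityˡ 0# ⟩
      0#      ∎

    lowest-replicate : ∀ m cs → ∏[x+ replicate m c ++ cs ] m ≈ ∏[x+ cs ] 0
    lowest-replicate zero    cs = refl
    lowest-replicate (suc m) cs = begin
      c * ∏[x+ replicate m c ++ cs ] (suc m) + ∏[x+ replicate m c ++ cs ] m
        ≈⟨ +-cong (trans (*-congʳ c≈0) (zeroˡ _)) (lowest-replicate m cs) ⟩
      0# + ∏[x+ cs ] 0 ≈⟨ +-identityˡ _ ⟩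
      ∏[x+ cs ] 0      ∎

  order-++ : ∀ {n} bs cs → (∀ {k} → k ℕ.< n → ∏[x+ cs ] k ≈ 0#) → ∀ {k} → k ℕ.< n → ∏[x+ bs ++ cs ] k ≈ 0#
  order-++ []       cs ord k<n = ord k<n
  order-++ (b ∷ bs) cs ord {zero} k<n = trans (+-identityʳ _) (trans (*-congˡ (order-++ bs cs ord k<n)) (zeroʳ b))
  order-++ (b ∷ bs) cs ord {suc k} k<n =
    trans (+-cong (trans (*-congˡ (order-++ bs cs ord k<n)) (zeroʳ b)) (order-++ bs cs ord (ℕ.<-trans (ℕ.n<1+n k) k<n)))
          (+-identityˡ 0#)

  constant-replicate : ∀ m c cs → ∏[x+ replicate m c ++ cs ] 0 ≈ c ^ m * ∏[x+ cs ] 0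
  constant-replicate zero    c cs = sym (*-identityˡ _)
  constant-replicate (suc m) c cs =
    trans (+-identityʳ _) (trans (*-congˡ (constant-replicate m c cs)) (sym (*-assoc _ _ _)))

  binomial : ∀ a n k → ∏[x+ replicate n a ] k ≈ (n C k) ·ℕ (a ^ (n ∸ k))
  binomial a zero    zero    = sym (×-homo-1 _)
  binomial a zero    (suc k) = refl
  binomial a (suc n) zero    = begin
    a * ∏[x+ replicate n a ] 0 + 0# ≈⟨ +-identityʳ _ ⟩
    a * ∏[x+ replicate n a ] 0      ≈⟨ *-congˡ (binomial a n 0) ⟩
    a * ((n C 0) ·ℕ (a ^ n))        ≈⟨ ×-comm-* (n C 0) a _ ⟩
    (n C 0) ·ℕ (a ^ suc n)          ∎
  binomial a (suc n) (suc k) = begin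
    a * ∏[x+ replicate n a ] (suc k) + ∏[x+ replicate n a ] k
      ≈⟨ +-cong raised (binomial a n k) ⟩
    (n C suc k) ·ℕ (a ^ (n ∸ k)) + (n C k) ·ℕ (a ^ (n ∸ k))
      ≈⟨ +-comm _ _ ⟩
    (n C k) ·ℕ (a ^ (n ∸ k)) + (n C suc k) ·ℕ (a ^ (n ∸ k))
      ≈⟨ ×-homo-+ _ (n C k) (n C suc k) ⟨
    (n C k ℕ.+ n C suc k) ·ℕ (a ^ (n ∸ k))
      ≈⟨ ×-congˡ (nCk+nC[k+1]≡[n+1]C[k+1] n k) ⟩
    (suc n C suc k) ·ℕ (a ^ (suc n ∸ suc k)) ∎
    where
    raised : a * ∏[x+ replicate n a ] (suc k) ≈ (n C suc k) ·ℕ (a ^ (n ∸ k))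
    -- Only for k < n is n - k the successor of n - (k + 1). Otherwise truncated subtraction breaks
    -- this, but both sides are zero.
    raised with k ℕ.<? n
    ... | yes k<n = begin
      a * ∏[x+ replicate n a ] (suc k)         ≈⟨ *-congˡ (binomial a n (suc k)) ⟩
      a * ((n C suc k) ·ℕ (a ^ (n ∸ suc k)))   ≈⟨ ×-comm-* (n C suc k) a _ ⟩
      (n C suc k) ·ℕ (a ^ suc (n ∸ suc k))     ≈⟨ ×-congʳ (n C suc k) (reflexive (≡.cong (a ^_) (ℕ.+-∸-assoc 1 k<n))) ⟨
      (n C suc k) ·ℕ (a ^ (n ∸ k))             ∎
    ... | no k≮n = begin
      a * ∏[x+ replicate n a ] (suc k)         ≈⟨ *-congˡ (∏[x+]-degree (replicate n a) (≡.subst (ℕ._< suc k) (≡.sym (length-replicate n)) (s≤s (ℕ.≮⇒≥ k≮n)))) ⟩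
      a * 0#                                   ≈⟨ zeroʳ a ⟩
      0 ·ℕ (a ^ (n ∸ k))                       ≈⟨ ×-congˡ (k>n⇒nCk≡0 (s≤s (ℕ.≮⇒≥ k≮n))) ⟨
      (n C suc k) ·ℕ (a ^ (n ∸ k))             ∎

  -- Both sides are the trinomial coefficient n! / (k! q! (n-k-q)!) times a^(n-k-q).
  binomial-reciprocity : ∀ a {n k q} → k ≤ n → q ≤ n →
    ((n C k) ·ℕ 1#) * ∏[x+ replicate (n ∸ k) a ] q ≈ ∏[x+ replicate (n ∸ q) a ] k * ((n C q) ·ℕ 1#)
  binomial-reciprocity a {n} {k} {q} k≤n q≤n = begin
    ((n C k) ·ℕ 1#) * ∏[x+ replicate (n ∸ k) a ] q
      ≈⟨ trinomial k q ⟩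
    ((n C k) ℕ.* ((n ∸ k) C q)) ·ℕ (a ^ (n ∸ k ∸ q))
      ≈⟨ ×-congˡ (trinomial-sym k≤n q≤n) ⟩
    ((n C q) ℕ.* ((n ∸ q) C k)) ·ℕ (a ^ (n ∸ k ∸ q))
      ≈⟨ ×-congʳ ((n C q) ℕ.* ((n ∸ q) C k)) (reflexive (≡.cong (a ^_) (∸-∸-comm n k q))) ⟩
    ((n C q) ℕ.* ((n ∸ q) C k)) ·ℕ (a ^ (n ∸ q ∸ k))
      ≈⟨ trinomial q k ⟨
    ((n C q) ·ℕ 1#) * ∏[x+ replicate (n ∸ q) a ] k
      ≈⟨ *-comm _ _ ⟩
    ∏[x+ replicate (n ∸ q) a ] k * ((n C q) ·ℕ 1#) ∎
    where
    trinomial : ∀ k q → ((n C k) ·ℕ 1#) * ∏[x+ replicate (n ∸ k) a ] q ≈ ((n C k) ℕ.* ((n ∸ k) C q)) ·ℕ (a ^ (n ∸ k ∸ q))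
    trinomial k q = begin
      ((n C k) ·ℕ 1#) * ∏[x+ replicate (n ∸ k) a ] q            ≈⟨ ×-assoc-* (n C k) 1# _ ⟩
      (n C k) ·ℕ (1# * ∏[x+ replicate (n ∸ k) a ] q)            ≈⟨ ×-congʳ (n C k) (trans (*-identityˡ _) (binomial a (n ∸ k) q)) ⟩
      (n C k) ·ℕ (((n ∸ k) C q) ·ℕ (a ^ (n ∸ k ∸ q)))           ≈⟨ ×-assocˡ _ (n C k) _ ⟩
      ((n C k) ℕ.* ((n ∸ k) C q)) ·ℕ (a ^ (n ∸ k ∸ q))          ∎

  module _ where
    open Polynomial R using (X; const; coeff; coeff-+; coeff-scale; coeff-≈) renaming (commutativeRing to R[x])
    open CommutativeRing R[x] using () renaming (_+_ to _+ₚ_; _*_ to _*ₚ_; 1# to 1ₚ; *-assoc to *ₚ-assoc; *-identityˡ to *ₚ-identityˡ; commutativeSemiring to R[x]-commutativeSemiring)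
    open Exp R[x]-commutativeSemiring using () renaming (_^_ to _^ₚ_)

    -- Both `X` and `X +ₚ const a` compute to lists of the form `u ∷ 1# ∷ []`, with u being `0#` or
    -- `0# + a`, so one recurrence serves both factors.
    coeff-linear-* : ∀ u p k → coeff ((u ∷ 1# ∷ []) *ₚ p) k ≈ u * coeff p k + shift (coeff p) k
    coeff-linear-* u p k = begin
      coeff ((u ∷ 1# ∷ []) *ₚ p) k                      ≈⟨ coeff-+ (map (u *_) p) _ k ⟩
      coeff (map (u *_) p) k + coeff (0# ∷ 1ₚ *ₚ p) k   ≈⟨ +-cong (coeff-scale u p k) (shifted k) ⟩
      u * coeff p k + shift (coeff p) k                 ∎
      where
      shifted : ∀ k → coeff (0# ∷ 1ₚ *ₚ p) k ≈ shift (coeff p) k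
      shifted zero    = refl
      shifted (suc k) = coeff-≈ (*ₚ-identityˡ p) k

    coeff-[X+a]^n : ∀ a n k → coeff ((X +ₚ const a) ^ₚ n) k ≈ ∏[x+ replicate n a ] k
    coeff-[X+a]^n a zero    zero    = refl
    coeff-[X+a]^n a zero    (suc k) = refl
    coeff-[X+a]^n a (suc n) k       = trans (coeff-linear-* (0# + a) ((X +ₚ const a) ^ₚ n) k)
      (+-cong (*-cong (+-identityˡ a) (coeff-[X+a]^n a n k)) (shift-cong (coeff-[X+a]^n a n) k))

    coeff-X^j[X+a]^n : ∀ a j n k →
      coeff (X ^ₚ j *ₚ (X +ₚ const a) ^ₚ n) k ≈ ∏[x+ replicate j 0# ++ replicate n a ] k
    coeff-X^j[X+a]^n a zero    n k = trans (coeff-≈ (*ₚ-identityˡ ((X +ₚ const a) ^ₚ n)) k) (coeff-[X+a]^n a n k)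
    coeff-X^j[X+a]^n a (suc j) n k = begin
      coeff (X ^ₚ suc j *ₚ (X +ₚ const a) ^ₚ n) k        ≈⟨ coeff-≈ (*ₚ-assoc X (X ^ₚ j) _) k ⟩
      coeff (X *ₚ (X ^ₚ j *ₚ (X +ₚ const a) ^ₚ n)) k     ≈⟨ coeff-linear-* 0# (X ^ₚ j *ₚ (X +ₚ const a) ^ₚ n) k ⟩
      0# * coeff (X ^ₚ j *ₚ (X +ₚ const a) ^ₚ n) k + shift (coeff (X ^ₚ j *ₚ (X +ₚ const a) ^ₚ n)) k
        ≈⟨ +-cong (*-congˡ (coeff-X^j[X+a]^n a j n k)) (shift-cong (coeff-X^j[X+a]^n a j n) k) ⟩
      ∏[x+ replicate (suc j) 0# ++ replicate n a ] k ∎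

-- Finite products and images of natural numbers in a ring.

module ProductProperties {c ℓ} (R : CommutativeRing c ℓ) where

  open CommutativeRing R hiding (zero) renaming (Carrier to A)
  open Products R
  open Exp commutativeSemiring using (^-distrib-*)
  open Mult semiring using (×-homo-1; ×1-homo-*) renaming (_×_ to _·ℕ_)

  ∏-cong : ∀ {n} {f g : Fin n → A} → (∀ i → f i ≈ g i) → ∏ f ≈ ∏ g
  ∏-cong = MonoidSum.sum-cong-≋ *-commutativeMonoid

  1^n≈1 : ∀ n → 1# ^ n ≈ 1#
  1^n≈1 zero    = refl
  1^n≈1 (suc n) = trans (*-identityˡ _) (1^n≈1 n)

  ∏-^ : ∀ {n} m (f : Fin n → A) → (∏ f) ^ m ≈ ∏ (λ i → f i ^ m)
  ∏-^ {zero}  m f = 1^n≈1 m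
  ∏-^ {suc n} m f = trans (^-distrib-* (f zero) _ m) (*-congˡ (∏-^ m (f ∘ suc)))

  ∏-const : ∀ n x → ∏ {n} (λ _ → x) ≈ x ^ n
  ∏-const n x = MonoidSum.sum-replicate *-commutativeMonoid n

  ·1-^ : ∀ m k → (m ℕ.^ k) ·ℕ 1# ≈ (m ·ℕ 1#) ^ k
  ·1-^ m zero    = ×-homo-1 1#
  ·1-^ m (suc k) = trans (×1-homo-* m (m ℕ.^ k)) (*-congˡ (·1-^ m k))

  product-applyUpTo : ∀ (f : ℕ → ℕ) g n → product (map f (applyUpTo g n)) ·ℕ 1# ≈ ∏ {n} (λ i → f (g (toℕ i)) ·ℕ 1#)
  product-applyUpTo f g zero    = ×-homo-1 1#
  product-applyUpTo f g (suc n) = trans (×1-homo-* (f (g 0)) _) (*-congˡ (product-applyUpTo f (g ∘ suc) n))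

-- The confluent Vandermonde determinant by a Newton basis.

module ConfluentVandermonde {c ℓ} (R : CommutativeRing c ℓ) (d : ℕ) where

  open CommutativeRing R hiding (zero) renaming (Carrier to A)
  open Determinant R
  open Products R
  open ProductProperties R
  open DeterminantProperties R
  open LinearFactors R
  open Exp commutativeSemiring using (^-assocʳ; ^-congʳ; ^-congˡ)
  open Mult semiring using () renaming (_×_ to _·ℕ_)
  open SemiringSum semiring using (sum; sum-cong-≋; *-distribˡ-sum; sum-permute)
  open SetoidReasoning setoid

  -- The roots of the Newton basis: the blocks s ≥ i of D equal roots, with block i cut down to t of them.
  allRoots : ∀ {r} → (Fin r → A) → List A
  allRoots {zero}  a = []
  allRoots {suc r} a = replicate (D d) (- a zero) ++ allRoots (a ∘ suc)

  roots : ∀ {r} → (Fin r → A) → Fin r → ℕ → List A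
  roots a zero    t = replicate t (- a zero) ++ allRoots (a ∘ suc)
  roots a (suc i) t = roots (a ∘ suc) i t

  length-allRoots : ∀ {r} (a : Fin r → A) → length (allRoots a) ≡ r ℕ.* D d
  length-allRoots {zero}  a = ≡.refl
  length-allRoots {suc r} a = ≡.trans (length-++ (replicate (D d) (- a zero)))
    (≡.cong₂ ℕ._+_ (length-replicate (D d)) (length-allRoots (a ∘ suc)))

  -- The Newton polynomial in position q has degree n - 1 - q, like the monomial it replaces. The
  -- additive form lets the induction over blocks avoid truncated subtraction.
  toℕ-combine+length-roots : ∀ {r} (a : Fin r → A) i (j : Fin (D d)) →
    toℕ (combine i j) ℕ.+ suc (length (roots a i (toℕ (opposite j)))) ≡ r ℕ.* D d
  toℕ-combine+length-roots {suc r} a zero j = ≡.trans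
    (≡.cong₂ (λ x y → x ℕ.+ suc y) (toℕ-↑ˡ j (r ℕ.* D d))
      (≡.trans (length-++ (replicate t (- a zero))) (≡.cong₂ ℕ._+_ (length-replicate t) (length-allRoots (a ∘ suc)))))
    (≡.trans (≡.sym (ℕ.+-assoc (toℕ j) (suc t) (r ℕ.* D d)))
             (≡.cong (ℕ._+ r ℕ.* D d) (toℕ+suc-opposite j)))
    where t = toℕ (opposite j)
  toℕ-combine+length-roots {suc r} a (suc i) j = ≡.trans
    (≡.cong (ℕ._+ suc (length (roots (a ∘ suc) i (toℕ (opposite j))))) (toℕ-↑ʳ (D d) (combine i j)))
    (≡.trans (ℕ.+-assoc (D d) (toℕ (combine i j)) _) (≡.cong (D d ℕ.+_) (toℕ-combine+length-roots (a ∘ suc) i j)))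

  length-roots : ∀ {r} (a : Fin r → A) i (j : Fin (D d)) →
    length (roots a i (toℕ (opposite j))) ≡ toℕ (opposite (combine i j))
  length-roots a i j = ℕ.suc-injective (ℕ.+-cancelˡ-≡ (toℕ (combine i j)) _ _
    (≡.trans (toℕ-combine+length-roots a i j) (≡.sym (toℕ+suc-opposite (combine i j)))))

  translate-replicate-++ : ∀ x m y cs k →
    ∏[x+ map (x +_) (replicate m y ++ cs) ] k ≈ ∏[x+ replicate m (x + y) ++ map (x +_) cs ] k
  translate-replicate-++ x m y cs k = reflexive (≡.cong (λ cs → ∏[x+ cs ] k)
    (≡.trans (map-++ (x +_) (replicate m y) cs) (≡.cong (_++ map (x +_) cs) (map-replicate (x +_) m y))))

  -- Translation by `a i` turns the D entries `- a i` into zeros, hence into a factor x^D.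
  order-allRoots : ∀ {r} (a : Fin r → A) i {k} → k ℕ.< D d → ∏[x+ map (a i +_) (allRoots a) ] k ≈ 0#
  order-allRoots a zero {k} k<D =
    trans (translate-replicate-++ (a zero) (D d) (- a zero) (allRoots (a ∘ suc)) k)
          (order-replicate (-‿inverseʳ (a zero)) (D d) _ k<D)
  order-allRoots a (suc i) {k} k<D =
    trans (translate-replicate-++ (a (suc i)) (D d) (- a zero) (allRoots (a ∘ suc)) k)
          (order-++ (replicate (D d) (a (suc i) + - a zero)) _ (order-allRoots (a ∘ suc) i) k<D)

  -- Block i comes after block i′, so it occurs uncut in the list.
  order-roots-< : ∀ {r} (a : Fin r → A) {i i′} t → i′ < i → ∀ {k} → k ℕ.< D d →
                  ∏[x+ map (a i +_) (roots a i′ t) ] k ≈ 0#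
  order-roots-< a {suc i} {zero} t _ {k} k<D =
    trans (translate-replicate-++ (a (suc i)) t (- a zero) (allRoots (a ∘ suc)) k)
          (order-++ (replicate t (a (suc i) + - a zero)) _ (order-allRoots (a ∘ suc) i) k<D)
  order-roots-< a {suc i} {suc i′} t (s≤s i′<i) k<D = order-roots-< (a ∘ suc) t i′<i k<D

  order-roots : ∀ {r} (a : Fin r → A) i {t k} → k ℕ.< t → ∏[x+ map (a i +_) (roots a i t) ] k ≈ 0#
  order-roots a zero {t} {k} k<t =
    trans (translate-replicate-++ (a zero) t (- a zero) (allRoots (a ∘ suc)) k)
          (order-replicate (-‿inverseʳ (a zero)) t _ k<t)
  order-roots a (suc i) k<t = order-roots (a ∘ suc) i k<t

  constant-allRoots : ∀ {r} x (a : Fin r → A) → ∏[x+ map (x +_) (allRoots a) ] 0 ≈ ∏ (λ s → (x - a s) ^ D d)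
  constant-allRoots {zero}  x a = refl
  constant-allRoots {suc r} x a = trans
    (translate-replicate-++ x (D d) (- a zero) (allRoots (a ∘ suc)) 0)
    (trans (constant-replicate (D d) (x + - a zero) _) (*-congˡ (constant-allRoots x (a ∘ suc))))

  -- Translation turns the t cut-down roots into x^t, so coefficient t is the constant term of the
  -- remaining factors. These do not depend on t, so the diagonal is constant along a block.
  lowest-roots : ∀ {r} (a : Fin r → A) i t →
    ∏[x+ map (a i +_) (roots a i t) ] t ≈ ∏ (λ s → if does (i <? s) then (a i - a s) ^ D d else 1#)
  lowest-roots a zero t = begin
    ∏[x+ map (a zero +_) (roots a zero t) ] t
      ≈⟨ translate-replicate-++ (a zero) t (- a zero) (allRoots (a ∘ suc)) t ⟩
    ∏[x+ replicate t (a zero + - a zero) ++ map (a zero +_) (allRoots (a ∘ suc)) ] t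
      ≈⟨ lowest-replicate (-‿inverseʳ (a zero)) t _ ⟩
    ∏[x+ map (a zero +_) (allRoots (a ∘ suc)) ] 0
      ≈⟨ constant-allRoots (a zero) (a ∘ suc) ⟩
    ∏ (λ s → (a zero - a (suc s)) ^ D d)
      -- The new `1#` is the factor at s = i, where `i <? s` fails.
      ≈⟨ *-identityˡ _ ⟨
    1# * ∏ (λ s → (a zero - a (suc s)) ^ D d) ∎
  lowest-roots a (suc i) t = trans (lowest-roots (a ∘ suc) i t) (sym (*-identityˡ _))

  diag : ∀ {n} → (Fin n → A) → Matrix n
  diag x i k = x i * δ i k

  det-diag : ∀ {n} (x : Fin n → A) → det (diag x) ≈ ∏ x
  det-diag {n} x = trans (det-lower (diag x) (λ i<k → trans (*-congˡ (δ-< i<k)) (zeroʳ _)))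
                     (∏-cong {n} {λ i → diag x i i} {x} λ i → trans (*-congˡ (δ-diag i)) (*-identityʳ _))

  diag-· : ∀ {n} x (M : Matrix n) i k → (diag x · M) i k ≈ x i * M i k
  diag-· x M i k = begin
    sum (λ j → (x i * δ i j) * M j k) ≈⟨ sum-cong-≋ (λ j → trans (*-assoc _ _ _) (*-congˡ (trans (*-comm _ _) (*-congˡ (δ-sym i j))))) ⟩
    sum (λ j → x i * (M j k * δ j i)) ≈⟨ *-distribˡ-sum (x i) (λ j → M j k * δ j i) ⟨
    x i * sum (λ j → M j k * δ j i)   ≈⟨ *-congˡ (sum-δ (λ j → M j k) i) ⟩
    x i * M i k                       ∎

  ·-diag : ∀ {n} (M : Matrix n) y i k → (M · diag y) i k ≈ M i k * y k
  ·-diag M y i k = trans (sum-cong-≋ λ j → sym (*-assoc (M i j) _ _)) (sum-δ (λ j → M i j * y j) k)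

  module _ {r} (a : Fin r → A) where

    private
      n = r ℕ.* D d
      quot : Fin n → Fin r
      quot = quotient {r} (D d)
      rem : Fin n → Fin (D d)
      rem = remainder {r} (D d)

    -- Row (i, j) evaluates Hasse derivatives of order d - j at aᵢ, column q is the monomial x^(n - 1 - q).
    confluent : Matrix n
    confluent p q = ∏[x+ replicate (toℕ (opposite q)) (a (quot p)) ] (toℕ (opposite (rem p)))

    private
      basis : Fin n → List A
      basis q = roots a (quot q) (toℕ (opposite (rem q)))

      length-basis : ∀ q → length (basis q) ≡ toℕ (opposite q)
      length-basis q = ≡.trans (length-roots a (quot q) (rem q)) (≡.cong (toℕ ∘ opposite) (combine-remQuot {r} (D d) q))

      -- Columns are Newton polynomials: `newton` lists their coefficients from the highest power
      -- down, `triangular` their Hasse derivatives at the aᵢ.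
      newton triangular : Matrix n
      newton q q′     = ∏[x+ basis q′ ] (toℕ (opposite q))
      triangular p q′ = ∏[x+ map (a (quot p) +_) (basis q′) ] (toℕ (opposite (rem p)))

      det-newton : det newton ≈ 1#
      det-newton = trans
        (det-lower newton λ {q} {q′} q<q′ → ∏[x+]-degree (basis q′)
          (≡.subst (ℕ._< toℕ (opposite q)) (≡.sym (length-basis q′)) (opposite-anti-< q<q′)))
        (∏≈1 _ λ q → trans (reflexive (≡.cong ∏[x+ basis q ] (≡.sym (length-basis q)))) (∏[x+]-monic (basis q)))

      -- A Hasse derivative at aᵢ is linear in the polynomial, so expanding a Newton polynomial in
      -- monomials and applying row p termwise gives its derivative.
      confluent-·-newton : ∀ p q′ → (confluent · newton) p q′ ≈ triangular p q′
      confluent-·-newton p q′ = begin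
        sum {n} (λ q → ∏[x+ replicate (toℕ (opposite q)) x ] k * ∏[x+ basis q′ ] (toℕ (opposite q)))
          -- Sum over the exponent m = n - 1 - q instead of the column q.
          ≈⟨ sum-permute {n} {n} (λ m → ∏[x+ replicate (toℕ m) x ] k * ∏[x+ basis q′ ] (toℕ m)) reverse ⟨
        sum {n} (λ m → ∏[x+ replicate (toℕ m) x ] k * ∏[x+ basis q′ ] (toℕ m))
          ≈⟨ sum-cong-≋ {n} (λ m → trans (*-comm _ (∏[x+ basis q′ ] (toℕ m))) (*-congˡ (reflexive (≡.cong (λ cs → ∏[x+ cs ] k) (≡.sym (++-identityʳ (replicate (toℕ m) x))))))) ⟩
        sum {n} (λ m → ∏[x+ basis q′ ] (toℕ m) * ∏[x+ replicate (toℕ m) x ++ [] ] k)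
          ≈⟨ ∏[x+]-substitute x (basis q′) [] n (≡.subst (ℕ._< n) (≡.sym (length-basis q′)) (toℕ<n (opposite q′))) k ⟩
        ∏[x+ map (x +_) (basis q′) ++ [] ] k
          ≡⟨ ≡.cong (λ cs → ∏[x+ cs ] k) (++-identityʳ (map (x +_) (basis q′))) ⟩
        triangular p q′ ∎
        where
        x = a (quot p)
        k = toℕ (opposite (rem p))

      -- If q lies in an earlier block, the multiplicity D at aᵢ exceeds every order up to d. Within
      -- one block, the multiplicity d - j′ exceeds the order d - j.
      triangular-upper : ∀ {p q} → q < p → triangular p q ≈ 0#
      triangular-upper {p} {q} q<p with <-lexicographic {r} (D d) q p q<p
      ... | inj₁ i′<i = order-roots-< a (toℕ (opposite (rem q))) i′<i (toℕ<n (opposite (rem p)))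
      ... | inj₂ (i′≡i , j′<j) rewrite i′≡i = order-roots a (quot p) (opposite-anti-< j′<j)

    det-confluent : det confluent ≈ ∏[i<j] (λ i j → (a i - a j) ^ (D d ℕ.^ 2))
    det-confluent = begin
      det confluent                             ≈⟨ *-identityʳ _ ⟨
      det confluent * 1#                        ≈⟨ *-congˡ det-newton ⟨
      det confluent * det newton                ≈⟨ det-· confluent newton ⟨
      det (confluent · newton)                  ≈⟨ det-cong confluent-·-newton ⟩
      det triangular                            ≈⟨ det-upper triangular triangular-upper ⟩
      ∏ (λ p → triangular p p)                  ≈⟨ ∏-cong (λ p → lowest-roots a (quot p) (toℕ (opposite (rem p)))) ⟩
      ∏ (λ p → f (quot p))                      ≈⟨ SumProperties.sum-combine *-commutativeMonoid r (D d) (f ∘ quot) ⟩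
      ∏ {r} (λ i → ∏ {D d} (λ j → f (quot (combine i j))))
        ≈⟨ ∏-cong {r} (λ i → ∏-cong {D d} (λ j → reflexive (≡.cong (f ∘ proj₁) (remQuot-combine i j)))) ⟩
      ∏ (λ i → ∏ {D d} (λ j → f i))             ≈⟨ ∏-cong (λ i → ∏-const (D d) (f i)) ⟩
      ∏ (λ i → f i ^ D d)                       ≈⟨ ∏-cong (λ i → ∏-^ (D d) (λ s → if does (i <? s) then (a i - a s) ^ D d else 1#)) ⟩
      ∏ (λ i → ∏ (λ s → (if does (i <? s) then (a i - a s) ^ D d else 1#) ^ D d))
        ≈⟨ ∏-cong (λ i → ∏-cong (λ s → power (does (i <? s)) (a i - a s))) ⟩
      ∏[i<j] (λ i j → (a i - a j) ^ (D d ℕ.^ 2)) ∎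
      where
      f : Fin r → A
      f i = ∏ (λ s → if does (i <? s) then (a i - a s) ^ D d else 1#)
      power : ∀ b x → (if b then x ^ D d else 1#) ^ D d ≈ (if b then x ^ (D d ℕ.^ 2) else 1#)
      power false x = 1^n≈1 (D d)
      power true  x = trans (^-assocʳ x (D d) (D d)) (^-congʳ x (≡.cong (D d ℕ.*_) (≡.sym (ℕ.*-identityʳ (D d)))))

  -- From the Sylvester-Vandermonde matrix to the confluent one.

  module _ {r′} (a : Fin (suc r′) → A) where

    private
      r = suc r′
      n = r ℕ.* D d
      N = T r d ℕ.+ d
      quot : Fin n → Fin r
      quot = quotient {r} (D d)
      rem : Fin n → Fin (D d)
      rem = remainder {r} (D d)

      -- With r a successor, `r ∸ 1` in `T` computes. The equation turns the reversed index n - 1 -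
      -- q into the exponent N - q.
      n≡1+N : n ≡ suc N
      n≡1+N = ≡.trans (≡.cong suc (ℕ.+-comm d (r′ ℕ.* D d))) (≡.cong (λ m → suc (m ℕ.+ d)) (ℕ.*-comm r′ (D d)))

      -- `blocks` is the matrix of the row operation: block diagonal, with the coefficients of (x +
      -- aᵢ)^j as row j of block i.
      V powers blocks : Matrix n
      V          = sylvesterVandermonde r d R a
      powers p q = ∏[x+ replicate (toℕ (rem p) ℕ.+ T r d) (a (quot p)) ] (toℕ q)
      blocks p p′ = δ (quot p) (quot p′) * ∏[x+ replicate (toℕ (rem p)) (a (quot p)) ] (toℕ (rem p′))

      det-blocks : det blocks ≈ 1#
      det-blocks = trans (det-lower blocks lower) (∏≈1 _ λ p → begin
        δ (quot p) (quot p) * ∏[x+ replicate (toℕ (rem p)) (a (quot p)) ] (toℕ (rem p))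
          ≈⟨ *-congʳ (δ-diag (quot p)) ⟩
        1# * ∏[x+ replicate (toℕ (rem p)) (a (quot p)) ] (toℕ (rem p))
          ≈⟨ *-identityˡ _ ⟩
        ∏[x+ replicate (toℕ (rem p)) (a (quot p)) ] (toℕ (rem p))
          ≡⟨ ≡.cong ∏[x+ replicate (toℕ (rem p)) (a (quot p)) ] (≡.sym (length-replicate (toℕ (rem p)))) ⟩
        ∏[x+ replicate (toℕ (rem p)) (a (quot p)) ] (length (replicate (toℕ (rem p)) (a (quot p))))
          ≈⟨ ∏[x+]-monic (replicate (toℕ (rem p)) (a (quot p))) ⟩
        1# ∎)
        where
        lower : ∀ {p p′} → p < p′ → blocks p p′ ≈ 0#
        lower {p} {p′} p<p′ with <-lexicographic {r} (D d) p p′ p<p′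
        ... | inj₁ i<i′ = trans (*-congʳ (δ-< i<i′)) (zeroˡ _)
        ... | inj₂ (_ , j<j′) = trans (*-congˡ (∏[x+]-degree (replicate (toℕ (rem p)) (a (quot p)))
                (≡.subst (ℕ._< toℕ (rem p′)) (≡.sym (length-replicate (toℕ (rem p)))) j<j′))) (zeroʳ _)

      blocks-·-V : ∀ p q → (blocks · V) p q ≈ powers p q
      blocks-·-V p q = begin
        sum (λ p′ → blocks p p′ * V p′ q)
          ≈⟨ sum-cong-≋ (λ p′ → *-congˡ {blocks p p′} (coeff-X^j[X+a]^n (a (quot p′)) (toℕ (rem p′)) (T r d) (toℕ q))) ⟩
        sum (λ p′ → g (remQuot {r} (D d) p′))
          ≈⟨ SumProperties.sum-combine +-commutativeMonoid r (D d) (g ∘ remQuot {r} (D d)) ⟩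
        sum {r} (λ i′ → sum {D d} (λ j′ → g (remQuot {r} (D d) (combine i′ j′))))
          ≈⟨ sum-cong-≋ {r} (λ i′ → sum-cong-≋ {D d} (λ j′ → reflexive (≡.cong g (remQuot-combine i′ j′)))) ⟩
        sum (λ i′ → sum (λ j′ → (δ i i′ * h j′) * v i′ j′))
          ≈⟨ sum-cong-≋ (λ i′ → trans (sum-cong-≋ (λ j′ → *-assoc (δ i i′) (h j′) (v i′ j′))) (sym (*-distribˡ-sum (δ i i′) (λ j′ → h j′ * v i′ j′)))) ⟩
        sum (λ i′ → δ i i′ * sum (λ j′ → h j′ * v i′ j′))
          ≈⟨ sum-cong-≋ (λ i′ → trans (*-comm _ (sum (λ j′ → h j′ * v i′ j′))) (*-congˡ (δ-sym i i′))) ⟩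
        sum (λ i′ → sum (λ j′ → h j′ * v i′ j′) * δ i′ i)
          ≈⟨ sum-δ (λ i′ → sum (λ j′ → h j′ * v i′ j′)) i ⟩
        sum (λ j′ → h j′ * v i j′)
          -- Substitution with b = 0 is the expansion of (x + aᵢ)^j in powers of x, multiplied
          -- throughout by (x + aᵢ)^T.
          ≈⟨ ∏[x+]-substitute 0# (replicate j (a i)) (replicate (T r d) (a i)) (D d)
               (≡.subst (ℕ._< D d) (≡.sym (length-replicate j)) (toℕ<n (rem p))) (toℕ q) ⟩
        ∏[x+ map (0# +_) (replicate j (a i)) ++ replicate (T r d) (a i) ] (toℕ q)
          ≈⟨ ∏[x+]-cong (merge j) (toℕ q) ⟩
        powers p q ∎
        where
        i = quot p
        j = toℕ (rem p)
        h : Fin (D d) → A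
        h j′ = ∏[x+ replicate j (a i) ] (toℕ j′)
        v : Fin r → Fin (D d) → A
        v i′ j′ = ∏[x+ replicate (toℕ j′) 0# ++ replicate (T r d) (a i′) ] (toℕ q)
        g : Fin r × Fin (D d) → A
        g (i′ , j′) = (δ i i′ * h j′) * v i′ j′
        merge : ∀ j → Pointwise _≈_ (map (0# +_) (replicate j (a i)) ++ replicate (T r d) (a i)) (replicate (j ℕ.+ T r d) (a i))
        merge zero    = Pointwise.refl refl
        merge (suc j) = +-identityˡ (a i) ∷ merge j

      rowScale columnScale : Fin n → A
      rowScale p    = (N C toℕ (opposite (rem p))) ·ℕ 1#
      columnScale q = (N C toℕ q) ·ℕ 1#

      opposite≤d : (j : Fin (D d)) → toℕ (opposite j) ≤ d
      opposite≤d j = ℕ.s≤s⁻¹ (toℕ<n (opposite j))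

      -- The quotient C(N,q) / C(N,k) is cross-multiplied: C(N,k) scales the rows on the left and
      -- becomes the denominator of C, C(N,q) scales the columns on the right and becomes the
      -- numerator.
      rescale : ∀ p q → (diag rowScale · powers) p q ≈ (confluent a · diag columnScale) p q
      rescale p q = begin
        (diag rowScale · powers) p q
          ≈⟨ diag-· rowScale powers p q ⟩
        rowScale p * powers p q
          -- T + j = N - k, because k = d - j.
          ≡⟨ ≡.cong (λ m → rowScale p * ∏[x+ replicate m (a (quot p)) ] (toℕ q)) exponent ⟩
        rowScale p * ∏[x+ replicate (N ∸ k) (a (quot p)) ] (toℕ q)
          ≈⟨ binomial-reciprocity (a (quot p)) (ℕ.m≤n⇒m≤o+n (T r d) (opposite≤d (rem p))) (ℕ.s≤s⁻¹ (≡.subst (toℕ q ℕ.<_) n≡1+N (toℕ<n q))) ⟩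
        ∏[x+ replicate (N ∸ toℕ q) (a (quot p)) ] k * columnScale q
          ≡⟨ ≡.cong (λ m → ∏[x+ replicate m (a (quot p)) ] k * columnScale q) (≡.sym (≡.trans (opposite-prop q) (≡.cong (_∸ suc (toℕ q)) n≡1+N))) ⟩
        confluent a p q * columnScale q
          ≈⟨ ·-diag (confluent a) columnScale p q ⟨
        (confluent a · diag columnScale) p q ∎
        where
        k = toℕ (opposite (rem p))
        exponent : toℕ (rem p) ℕ.+ T r d ≡ N ∸ k
        exponent = ≡.trans (ℕ.+-comm _ (T r d)) (≡.trans
          (≡.cong (T r d ℕ.+_) (≡.trans (≡.sym (ℕ.m∸[m∸n]≡n (ℕ.s≤s⁻¹ (toℕ<n (rem p))))) (≡.cong (d ∸_) (≡.sym (opposite-prop (rem p))))))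
          (≡.sym (ℕ.+-∸-assoc (T r d) (opposite≤d (rem p)))))

      det-rescaled : ∏ rowScale * det V ≈ ∏ columnScale * ∏[i<j] (λ i j → (a i - a j) ^ (D d ℕ.^ 2))
      det-rescaled = begin
        ∏ rowScale * det V                               ≈⟨ *-cong (det-diag rowScale) (*-identityˡ _) ⟨
        det (diag rowScale) * (1# * det V)               ≈⟨ *-congˡ (*-congʳ det-blocks) ⟨
        det (diag rowScale) * (det blocks * det V)       ≈⟨ *-congˡ (trans (sym (det-· blocks V)) (det-cong blocks-·-V)) ⟩
        det (diag rowScale) * det powers                 ≈⟨ det-· (diag rowScale) powers ⟨
        det (diag rowScale · powers)                     ≈⟨ det-cong rescale ⟩
        det (confluent a · diag columnScale)             ≈⟨ det-· (confluent a) (diag columnScale) ⟩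
        det (confluent a) * det (diag columnScale)       ≈⟨ *-comm _ _ ⟩
        det (diag columnScale) * det (confluent a)       ≈⟨ *-cong (det-diag columnScale) (det-confluent a) ⟩
        ∏ columnScale * ∏[i<j] (λ i j → (a i - a j) ^ (D d ℕ.^ 2)) ∎

      ∏-columnScale : ∏ columnScale ≈ numerator r d ·ℕ 1#
      ∏-columnScale = trans (sym (product-applyUpTo (N C_) id n))
        (reflexive (≡.cong (λ m → product (map (N C_) (upTo m)) ·ℕ 1#) n≡1+N))

      ∏-rowScale : ∏ rowScale ≈ denominator r d ·ℕ 1#
      ∏-rowScale = begin
        ∏ rowScale
          ≈⟨ SumProperties.sum-combine *-commutativeMonoid r (D d) rowScale ⟩
        ∏ {r} (λ i → ∏ {D d} (λ j → rowScale (combine i j)))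
          ≈⟨ ∏-cong {r} (λ i → ∏-cong {D d} (λ j → reflexive (≡.cong (λ ij → (N C toℕ (opposite (proj₂ ij))) ·ℕ 1#) (remQuot-combine i j)))) ⟩
        ∏ {r} (λ i → ∏ {D d} (λ j → (N C toℕ (opposite j)) ·ℕ 1#))
          ≈⟨ ∏-const r _ ⟩
        (∏ {D d} (λ j → (N C toℕ (opposite j)) ·ℕ 1#)) ^ r
          -- In each of the r blocks, k = d - j runs through 0, ..., d in reverse.
          ≈⟨ ^-congˡ r (MonoidSum.sum-permute *-commutativeMonoid {D d} {D d} (λ j → (N C toℕ j) ·ℕ 1#) reverse) ⟨
        (∏ {D d} (λ j → (N C toℕ j) ·ℕ 1#)) ^ r
          ≈⟨ ∏-^ {D d} r (λ j → (N C toℕ j) ·ℕ 1#) ⟩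
        ∏ {D d} (λ j → ((N C toℕ j) ·ℕ 1#) ^ r)
          ≈⟨ ∏-cong {D d} (λ j → ·1-^ (N C toℕ j) r) ⟨
        ∏ {D d} (λ j → ((N C toℕ j) ℕ.^ r) ·ℕ 1#)
          ≈⟨ product-applyUpTo (λ j → (N C j) ℕ.^ r) id (D d) ⟨
        denominator r d ·ℕ 1# ∎

    -- The division-free form of the theorem, valid where the denominator need not be invertible.
    det-sylvesterVandermonde :
      (denominator r d ·ℕ 1#) * det (sylvesterVandermonde r d R a)
        ≈ (numerator r d ·ℕ 1#) * ∏[i<j] (λ i j → (a i - a j) ^ (D d ℕ.^ 2))
    det-sylvesterVandermonde = trans (*-congʳ (sym ∏-rowScale)) (trans det-rescaled (*-congʳ ∏-columnScale))

-- Dividing by the denominator in ℚ[a].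

ℕ→ℚ : ℕ → ℚ
ℕ→ℚ m = m ·ℕ 1ℚ
  where open Mult (CommutativeRing.semiring (ℚ[a] 0)) using () renaming (_×_ to _·ℕ_)

toℚᵘ-ℕ→ℚ : ∀ m → toℚᵘ (ℕ→ℚ m) ℚᵘ.≃ mkℚᵘ (pos m) 0
toℚᵘ-ℕ→ℚ zero    = *≡* ≡.refl
toℚᵘ-ℕ→ℚ (suc m) = ℚᵘ.≃-trans (toℚᵘ-homo-+ 1ℚ (ℕ→ℚ m))
  (ℚᵘ.≃-trans (ℚᵘ.+-congʳ ℚᵘ.1ℚᵘ (toℚᵘ-ℕ→ℚ m)) (*≡* (≡.cong (λ z → (pos 1 ℤ.+ z) ℤ.* pos 1) (ℤ.*-identityʳ (pos m)))))

-- Unnormalised fractions avoid the gcd of normalisation and leave an equation between integers.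
[m/n]*n≡m : ∀ m n .{{_ : NonZero n}} → (pos m ℚ./ n) ℚ.* (ℕ→ℚ n) ≡ ℕ→ℚ m
[m/n]*n≡m m n@(suc n-1) = toℚᵘ-injective (begin
  toℚᵘ ((pos m ℚ./ n) ℚ.* (ℕ→ℚ n))       ≈⟨ toℚᵘ-homo-* (pos m ℚ./ n) (ℕ→ℚ n) ⟩
  toℚᵘ (pos m ℚ./ n) ℚᵘ.* toℚᵘ (ℕ→ℚ n)   ≈⟨ ℚᵘ.*-cong (toℚᵘ-fromℚᵘ (mkℚᵘ (pos m) n-1)) (toℚᵘ-ℕ→ℚ n) ⟩
  mkℚᵘ (pos m) n-1 ℚᵘ.* mkℚᵘ (pos n) 0       ≈⟨ *≡* (≡.trans (ℤ.*-identityʳ (pos m ℤ.* pos n)) (≡.cong (λ k → pos m ℤ.* pos k) (≡.sym (ℕ.*-identityʳ n)))) ⟩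
  mkℚᵘ (pos m) 0                           ≈⟨ toℚᵘ-ℕ→ℚ m ⟨
  toℚᵘ (ℕ→ℚ m)                         ∎)
  where open SetoidReasoning ℚᵘ.≃-setoid

module _ {c ℓ} (R : CommutativeRing c ℓ) where
  open CommutativeRing R hiding (zero) renaming (Carrier to A)
  open Polynomial R using (const; _≈ₚ_; mk) renaming (commutativeRing to R[x])
  private module R[x] = CommutativeRing R[x]
  open Mult semiring using () renaming (_×_ to _·ℕ_)
  open Mult R[x].semiring using () renaming (_×_ to _·ℕₚ_)

  const-cong : ∀ {x y} → x ≈ y → const x ≈ₚ const y
  const-cong x≈y = mk λ { zero → x≈y ; (suc n) → refl }

  const-* : ∀ x y → const (x * y) ≈ₚ const x R[x].* const y
  const-* x y = mk λ { zero → sym (+-identityʳ (x * y)) ; (suc n) → refl }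

  const-·ℕ : ∀ m x → const (m ·ℕ x) ≈ₚ m ·ℕₚ const x
  -- `const 0#` is `0# ∷ []`, which equals the zero polynomial `[]` only up to trailing zeros.
  const-·ℕ zero    x = mk λ { zero → refl ; (suc n) → refl }
  const-·ℕ (suc m) x = R[x].+-congˡ (const-·ℕ m x)

fromℚ-* : ∀ r p q → let open CommutativeRing (ℚ[a] r) in fromℚ r (p ℚ.* q) ≈ fromℚ r p * fromℚ r q
fromℚ-* zero    p q = ≡.refl
fromℚ-* (suc r) p q = trans (const-cong (ℚ[a] r) (fromℚ-* r p q)) (const-* (ℚ[a] r) (fromℚ r p) (fromℚ r q))
  where open CommutativeRing (ℚ[a] (suc r))

-- `ℕ→ℚ` is a repeated sum of `1ℚ`, so the embedding of ℚ carries it to the multiples of `1#` in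
-- which the determinant identity is phrased.
fromℚ-ℕ→ℚ : ∀ r m → let open CommutativeRing (ℚ[a] r) in
  fromℚ r (ℕ→ℚ m) ≈ Mult._×_ semiring m 1#
fromℚ-ℕ→ℚ zero    m = ≡.refl
fromℚ-ℕ→ℚ (suc r) m = trans (const-cong (ℚ[a] r) (fromℚ-ℕ→ℚ r m)) (const-·ℕ (ℚ[a] r) m 1ᵣ)
  where
  open CommutativeRing (ℚ[a] (suc r))
  open CommutativeRing (ℚ[a] r) using () renaming (1# to 1ᵣ)

module _ (r : ℕ) where
  open CommutativeRing (ℚ[a] r) hiding (zero)
  open Mult semiring using (×-homo-1) renaming (_×_ to _·ℕ_)
  open SetoidReasoning setoid

  fromℚ-[m/n]*n : ∀ m n .{{_ : NonZero n}} → fromℚ r (pos m ℚ./ n) * (n ·ℕ 1#) ≈ m ·ℕ 1#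
  fromℚ-[m/n]*n m n = begin
    fromℚ r (pos m ℚ./ n) * (n ·ℕ 1#)   ≈⟨ *-congˡ (fromℚ-ℕ→ℚ r n) ⟨
    fromℚ r (pos m ℚ./ n) * fromℚ r (ℕ→ℚ n) ≈⟨ fromℚ-* r (pos m ℚ./ n) (ℕ→ℚ n) ⟨
    fromℚ r ((pos m ℚ./ n) ℚ.* ℕ→ℚ n)      ≡⟨ ≡.cong (fromℚ r) ([m/n]*n≡m m n) ⟩
    fromℚ r (ℕ→ℚ m) ≈⟨ fromℚ-ℕ→ℚ r m ⟩
    m ·ℕ 1#                           ∎

  -- ℚ[a] is not a field, but n is a unit there, with its inverse coming from ℚ.
  divide : ∀ m n .{{_ : NonZero n}} {x y} → (n ·ℕ 1#) * x ≈ (m ·ℕ 1#) * y → x ≈ fromℚ r (pos m ℚ./ n) * y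
  divide m n {x} {y} nx≈my = begin
    x                                          ≈⟨ 1/n*[n*z]≈z x ⟨
    1/n * ((n ·ℕ 1#) * x)                      ≈⟨ *-congˡ nx≈my ⟩
    -- Writing m as n times m/n lets the same cancellation finish the right-hand side.
    1/n * ((m ·ℕ 1#) * y)                      ≈⟨ *-congˡ (*-congʳ (trans (sym (fromℚ-[m/n]*n m n)) (*-comm _ _))) ⟩
    1/n * (((n ·ℕ 1#) * fromℚ r (pos m ℚ./ n)) * y) ≈⟨ *-congˡ (*-assoc _ _ _) ⟩
    1/n * ((n ·ℕ 1#) * (fromℚ r (pos m ℚ./ n) * y)) ≈⟨ 1/n*[n*z]≈z _ ⟩
    fromℚ r (pos m ℚ./ n) * y                    ∎
    where
    1/n : Carrier
    1/n = fromℚ r (pos 1 ℚ./ n)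
    1/n*[n*z]≈z : ∀ z → 1/n * ((n ·ℕ 1#) * z) ≈ z
    1/n*[n*z]≈z z = begin
      1/n * ((n ·ℕ 1#) * z) ≈⟨ *-assoc _ _ _ ⟨
      (1/n * (n ·ℕ 1#)) * z ≈⟨ *-congʳ (trans (fromℚ-[m/n]*n 1 n) (×-homo-1 1#)) ⟩
      1# * z                ≈⟨ *-identityˡ z ⟩
      z                     ∎

lemma3p1 : (r d : ℕ) → 2 ≤ r →
    let open CommutativeRing (ℚ[a] r)
        open Determinant (ℚ[a] r)
        open Products (ℚ[a] r)
    in det (sylvesterVandermonde r d (ℚ[a] r) var)
         ≈ fromℚ r (constantC r d) * ∏[i<j] (λ (i j : Fin r) → (var i - var j) ^ (D d ℕ.^ 2))
lemma3p1 r@(suc r′) d _ = divide r (numerator r d) (denominator r d) {{denominator-nonZero r d}}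
  (ConfluentVandermonde.det-sylvesterVandermonde (ℚ[a] r) d {r′} var)
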